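{- Let $T$ be an o-minimal theory with monster model $\mathbb{M}$, and assume there are $0$-definable unary functions $f_1,\ldots,f_k$ such that for every set $A\subseteq\mathbb{M}$, $\mathrm{dcl}(A)=f_1(A)\cup\cdots\cup f_k(A)\cup\mathrm{dcl}(\emptyset)$. If $(\mathbb{M},\mathbb{H})$ is the monster model of the theory $T^{\mathrm{indep}}$ of $H$-structures of $T$, then $o(\mathbb{H})=e(\mathbb{H})$.
   Context: Conventions. $T$ is a complete first-order theory in a language $L$ with an infinite model. Fix a strongly inaccessible cardinal $\lambda>|L|$; the monster model of a complete theory is its saturated model of cardinality $\lambda$ (unique up to isomorphism), and "small" means of cardinality $<\lambda$. For $\mathbb{D}\subseteq\mathbb{M}$, $(\mathbb{M},\mathbb{D})$ is the expansion of $\mathbb{M}$ by a new predicate interpreted as $\mathbb{D}$, and $o(\mathbb{D})=\{\mathbb{D}'\subseteq\mathbb{M}\mid(\mathbb{M},\mathbb{D})\cong(\mathbb{M},\mathbb{D}')\}=\{f(\mathbb{D})\mid f\in\mathrm{Aut}(\mathbb{M})\}$, $e(\mathbb{D})=\{\mathbb{D}'\subseteq\mathbb{M}\mid(\mathbb{M},\mathbb{D})\equiv(\mathbb{M},\mathbb{D}')\}$. An o-minimal theory is the complete theory of a densely ordered o-minimal structure; in such a theory $\mathrm{dcl}=\mathrm{acl}$, and o-minimal theories are geometric ($\mathrm{acl}$ satisfies exchange in models of $T$ and $T$ eliminates $\exists^\infty$). "$0$-definable" means definable without parameters. $H$-structures. Let $T$ be geometric and $L_H=L\cup\{H\}$ with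 $H$ a new unary predicate. An $L_H$-structure $(M,H(M))$ with $M\models T$ is an $H$-structure if $H(M)$ is an algebraically independent set and: (Density) for every finite $A\subseteq M$, every non-algebraic $L$-type $q(x)\in S_1(A)$ has a realization in $H(M)$; (Extension) for every finite $A\subseteq M$, every non-algebraic $L$-type $q(x)\in S_1(A)$ has a realization $a\in M$ with $a\notin\mathrm{acl}(A\cup H(M))$. Here $\mathrm{acl}$ is in the sense of $L$. All $H$-structures of $T$ are elementarily equivalent; their common complete theory is denoted $T^{\mathrm{indep}}$ (the theory of $H$-structures of $T$). It is axiomatized by $T$ together with: the elements of $H$ are algebraically independent; if $\varphi(\bar a,x)$ ($\varphi\in L$) has infinitely many solutions, it has a solution in $H$; if $\varphi(\bar a,x)$ has infinitely many solutions and, for every $\bar y$, $\psi(\bar a,\bar y,x)$ has fewer than $k$ solutions, then some solution $x$ of $\varphi(\bar a,x)$ satisfies $\neg\psi(\bar a,\bar y,x)$ for all $\bar y$ from $H$ ($\varphi,\psi\in L$). Every $\omega$-saturated model of $T^{\mathrm{indep}}$ is an $H$-structure. The $L$-reduct of the monster model of $T^{\mathrm{indep}}$ is identified with $\mathbb{M}$, and $\mathbb{H}=H(\mathbb{M})$. -}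

module Defs where

open import Level using (Level; Lift; suc; _⊔_)
open import Data.Bool.Base using (Bool)
open import Data.Empty.Polymorphic using (⊥)
open import Data.Fin.Base using (Fin)
open import Data.List.Base using (List)
open import Data.List.Membership.Propositional using (_∈_)
open import Data.List.Relation.Unary.All using (All)
open import Data.List.Relation.Unary.Any using (Any)
open import Data.Nat.Base as ℕ using (ℕ)
open import Data.Product.Base using (Σ-syntax; ∃; ∃-syntax; _×_; _,_)
open import Data.Sum.Base using (_⊎_)
open import Data.Vec.Base as Vec using (Vec; []; _∷_)
import Data.Vec.Relation.Unary.All as VecAll
open import Function.Bundles using (_⇔_; _↔_; Inverse)
open import Induction.WellFounded using (WellFounded)
open import Relation.Binary.Core using (Rel)
open import Relation.Binary.PropositionalEquality.Core using (_≡_)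
open import Relation.Binary.Structures using (IsStrictTotalOrder; IsDenseLinearOrder)
import Relation.Binary.Construct.Add.Extrema.Strict as Extrema
open import Relation.Nullary.Construct.Add.Extrema using (_±; [_])
open import Relation.Nullary.Negation.Core using (¬_)
open import Relation.Unary using (Pred; U; _∪_; _∖_; ｛_｝; _≐_)

private
  variable
    a ℓ p t : Level

-- A cardinal is an initial ordinal: a well-order that does not inject into
-- any of its proper initial segments.

module _ {Λ : Set ℓ} (_<_ : Rel Λ ℓ) where

  -- An injection of the subset P of X into the initial segment below α.
  -- (The values outside P are irrelevant.)
  InjectsBelow : {X : Set a} → Pred X p → Λ → Set (a ⊔ ℓ ⊔ p)
  InjectsBelow {X = X} P α =
    Σ[ f ∈ (X → Λ) ]
      (∀ {x} → P x → f x < α) ×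
      (∀ {x y} → P x → P y → f x ≡ f y → x ≡ y)

record Cardinal (ℓ : Level) : Set (suc ℓ) where
  field
    Carrier            : Set ℓ
    _<_                : Rel Carrier ℓ
    isStrictTotalOrder : IsStrictTotalOrder _≡_ _<_
    wellFounded        : WellFounded _<_
    initial            : ∀ α → ¬ InjectsBelow _<_ {X = Carrier} U α

CardLess : {X : Set a} → Pred X p → Cardinal ℓ → Set (a ⊔ ℓ ⊔ p)
CardLess P κ = ∃[ α ] InjectsBelow (Cardinal._<_ κ) P α

record IsStronglyInaccessible (κ : Cardinal ℓ) : Set ℓ where
  open Cardinal κ
  field
    uncountable : CardLess {X = ℕ} U κ
    regular     : ∀ α (f : Carrier → Carrier) →
                  ∃[ β ] (∀ γ → γ < α → f γ < β)
    -- Two maps Carrier → Bool represent the same subset of the segment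
    -- below α iff they agree below α; so g is an injection of the power
    -- set of that segment into the segment below β.
    strongLimit : ∀ α → ∃[ β ] Σ[ g ∈ ((Carrier → Bool) → Carrier) ]
                  (∀ s → g s < β) ×
                  (∀ s t → g s ≡ g t ⇔ (∀ γ → γ < α → s γ ≡ t γ))

record Language (ℓ : Level) : Set (suc ℓ) where
  field
    Func     : ℕ → Set ℓ
    Relation : ℕ → Set ℓ

open Language

Symbol : Language ℓ → Set ℓ
Symbol L = ∃ (Func L) ⊎ ∃ (Relation L)

data Term (L : Language ℓ) (n : ℕ) : Set ℓ where
  var : Fin n → Term L n
  app : ∀ {k} → Func L k → Vec (Term L n) k → Term L n

-- De Bruijn variables: `all` binds variable zero. The remaining connectives
-- are the classical abbreviations.
data Formula (L : Language ℓ) (n : ℕ) : Set ℓ where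
  falsum : Formula L n
  _≈_    : Term L n → Term L n → Formula L n
  rel    : ∀ {k} → Relation L k → Vec (Term L n) k → Formula L n
  _⇒_    : Formula L n → Formula L n → Formula L n
  all    : Formula L (ℕ.suc n) → Formula L n

neg : {L : Language ℓ} {n : ℕ} → Formula L n → Formula L n
neg φ = φ ⇒ falsum

Sentence : Language ℓ → Set ℓ
Sentence L = Formula L 0

record Structure (L : Language ℓ) : Set (suc ℓ) where
  field
    Carrier : Set ℓ
    funcInt : ∀ {k} → Func L k → Vec Carrier k → Carrier
    relInt  : ∀ {k} → Relation L k → Vec Carrier k → Set ℓ

∣_∣ : {L : Language ℓ} → Structure L → Set ℓ
∣ M ∣ = Structure.Carrier M

module _ {L : Language ℓ} (M : Structure L) where
  open Structure M

  mutual
    eval : ∀ {n} → Term L n → Vec ∣ M ∣ n → ∣ M ∣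
    eval (var i)    ρ = Vec.lookup ρ i
    eval (app f ts) ρ = funcInt f (evals ts ρ)

    evals : ∀ {n k} → Vec (Term L n) k → Vec ∣ M ∣ n → Vec ∣ M ∣ k
    evals []       ρ = []
    evals (s ∷ ts) ρ = eval s ρ ∷ evals ts ρ

  Sat : ∀ {n} → Formula L n → Vec ∣ M ∣ n → Set ℓ
  Sat falsum     ρ = ⊥
  Sat (s ≈ s′)   ρ = eval s ρ ≡ eval s′ ρ
  Sat (rel R ts) ρ = relInt R (evals ts ρ)
  Sat (φ ⇒ ψ)    ρ = Sat φ ρ → Sat ψ ρ
  Sat (all φ)    ρ = ∀ x → Sat φ (x ∷ ρ)

Theory : Language ℓ → (t : Level) → Set (ℓ ⊔ suc t)
Theory L t = Pred (Sentence L) t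

Th : {L : Language ℓ} → Structure L → Theory L ℓ
Th M σ = Sat M σ []

_⊨_ : {L : Language ℓ} → Structure L → Theory L t → Set (ℓ ⊔ t)
M ⊨ T = ∀ σ → T σ → Th M σ

ElementarilyEquivalent : {L : Language ℓ} → Structure L → Structure L → Set ℓ
ElementarilyEquivalent M N = Th M ≐ Th N

record _≅_ {L : Language ℓ} (M N : Structure L) : Set ℓ where
  field
    bijection : ∣ M ∣ ↔ ∣ N ∣
  open Inverse bijection using (to)
  field
    to-func : ∀ {k} (f : Func L k) (xs : Vec ∣ M ∣ k) →
              to (Structure.funcInt M f xs) ≡ Structure.funcInt N f (Vec.map to xs)
    to-rel  : ∀ {k} (R : Relation L k) (xs : Vec ∣ M ∣ k) →
              Structure.relInt M R xs ⇔ Structure.relInt N R (Vec.map to xs)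

Finite : {X : Set a} → Pred X p → Set (a ⊔ p)
Finite P = ∃[ xs ] (∀ {x} → P x → x ∈ xs)

module _ {L : Language ℓ} (M : Structure L) where

  -- A formula φ(x, ā) in one free variable x (variable zero) with
  -- parameters ā from M.
  ParamFormula : Set ℓ
  ParamFormula = Σ[ m ∈ ℕ ] Formula L (ℕ.suc m) × Vec ∣ M ∣ m

  negP : ParamFormula → ParamFormula
  negP (m , φ , ā) = m , neg φ , ā

  Over : Pred ∣ M ∣ p → Pred ParamFormula (ℓ ⊔ p)
  Over A (m , φ , ā) = VecAll.All A ā

  Solutions : ParamFormula → Pred ∣ M ∣ ℓ
  Solutions (m , φ , ā) x = Sat M φ (x ∷ ā)

  acl : Pred ∣ M ∣ p → Pred ∣ M ∣ (ℓ ⊔ p)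
  acl A b = ∃[ φ ] Over A φ × Finite (Solutions φ) × Solutions φ b

  dcl : Pred ∣ M ∣ p → Pred ∣ M ∣ (ℓ ⊔ p)
  dcl A b = ∃[ φ ] Over A φ × (Solutions φ ≐ ｛ b ｝)

  AlgebraicallyIndependent : Pred ∣ M ∣ ℓ → Set ℓ
  AlgebraicallyIndependent D = ∀ h → D h → ¬ acl (D ∖ ｛ h ｝) h

  IsZeroDefinable : (∣ M ∣ → ∣ M ∣) → Set ℓ
  IsZeroDefinable f =
    Σ[ φ ∈ Formula L 2 ] (∀ x y → Sat M φ (x ∷ y ∷ []) ⇔ f x ≡ y)

module _ {L : Language ℓ} (M : Structure L) where

  -- q ∈ S₁(A). Consistency with the elementary diagram of M over A is
  -- finite satisfiability in M.
  record IsType (A : Pred ∣ M ∣ ℓ) (q : Pred (ParamFormula M) ℓ) : Set ℓ where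
    field
      over        : ∀ {φ} → q φ → Over M A φ
      satisfiable : ∀ {φs} → All q φs → ∃[ x ] All (λ φ → Solutions M φ x) φs
      complete    : ∀ φ → Over M A φ → q φ ⊎ q (negP M φ)

  Realizes : ∣ M ∣ → Pred (ParamFormula M) ℓ → Set ℓ
  Realizes x q = ∀ {φ} → q φ → Solutions M φ x

  NonAlgebraic : Pred (ParamFormula M) ℓ → Set ℓ
  NonAlgebraic q = ∀ {φ} → q φ → ¬ Finite (Solutions M φ)

  -- For M of cardinality κ: M realizes all types over subsets of
  -- cardinality less than that of M.
  IsSaturated : Cardinal ℓ → Set (suc ℓ)
  IsSaturated κ = ∀ (A : Pred ∣ M ∣ ℓ) → CardLess A κ →
                  ∀ q → IsType A q → ∃[ x ] Realizes x q

record IsMonster {L : Language ℓ} (κ : Cardinal ℓ) (T : Theory L t)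
                 (M : Structure L) : Set (suc ℓ ⊔ t) where
  field
    model       : M ⊨ T
    cardinality : ∣ M ∣ ↔ Cardinal.Carrier κ
    saturated   : IsSaturated M κ

data ExpandedRelation (R : ℕ → Set ℓ) : ℕ → Set ℓ where
  old : ∀ {k} → R k → ExpandedRelation R k
  new : ExpandedRelation R 1

_+H : Language ℓ → Language ℓ
L +H = record { Func = Func L ; Relation = ExpandedRelation (Relation L) }

expand : {L : Language ℓ} (M : Structure L) → Pred ∣ M ∣ ℓ → Structure (L +H)
expand {ℓ} {L} M D = record
  { Carrier = ∣ M ∣
  ; funcInt = Structure.funcInt M
  ; relInt  = relInt′
  }
  where
  relInt′ : ∀ {k} → Relation (L +H) k → Vec ∣ M ∣ k → Set ℓ
  relInt′ (old R) xs       = Structure.relInt M R xs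
  relInt′ new     (x ∷ []) = D x

o : {L : Language ℓ} (M : Structure L) → Pred ∣ M ∣ ℓ → Pred (Pred ∣ M ∣ ℓ) ℓ
o M D D′ = expand M D ≅ expand M D′

e : {L : Language ℓ} (M : Structure L) → Pred ∣ M ∣ ℓ → Pred (Pred ∣ M ∣ ℓ) ℓ
e M D D′ = ElementarilyEquivalent (expand M D) (expand M D′)

-- Points, and open intervals with endpoints in R ∪ {-∞, +∞}.
data Piece (X : Set a) : Set a where
  point    : X → Piece X
  interval : X ± → X ± → Piece X

module _ {X : Set a} (_<_ : Rel X ℓ) where
  open Extrema _<_ using (_<±_)

  InPiece : X → Pred (Piece X) (a ⊔ ℓ)
  InPiece x (point y)      = Lift ℓ (x ≡ y)
  InPiece x (interval l u) = (l <± [ x ]) × ([ x ] <± u)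

  ⋃ : List (Piece X) → Pred X (a ⊔ ℓ)
  ⋃ ps x = Any (InPiece x) ps

module _ {L : Language ℓ} (lt : Relation L 2) where

  order : (R : Structure L) → Rel ∣ R ∣ ℓ
  order R x y = Structure.relInt R lt (x ∷ y ∷ [])

  record IsDenselyOrderedOMinimal (R : Structure L) : Set ℓ where
    field
      isDenseLinearOrder : IsDenseLinearOrder _≡_ (order R)
      infinite           : ¬ Finite {X = ∣ R ∣} U
      oMinimal           : ∀ φ → ∃[ ps ] (Solutions R φ ≐ ⋃ (order R) ps)

  IsOMinimalTheory : Theory L ℓ → Set (suc ℓ)
  IsOMinimalTheory T =
    Σ[ R ∈ Structure L ] IsDenselyOrderedOMinimal R × (T ≐ Th R)

record IsHStructure {L : Language ℓ} (T : Theory L t) (M : Structure L)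
                    (H : Pred ∣ M ∣ ℓ) : Set (suc ℓ ⊔ t) where
  field
    model       : M ⊨ T
    independent : AlgebraicallyIndependent M H
    density     : ∀ (xs : List ∣ M ∣) q → IsType M (_∈ xs) q → NonAlgebraic M q →
                  ∃[ x ] H x × Realizes M x q
    extension   : ∀ (xs : List ∣ M ∣) q → IsType M (_∈ xs) q → NonAlgebraic M q →
                  ∃[ x ] ¬ acl M ((_∈ xs) ∪ H) x × Realizes M x q

Tindep : {L : Language ℓ} → Theory L t → Theory (L +H) (suc ℓ ⊔ t)
Tindep T σ = ∀ M H → IsHStructure T M H → Th (expand M H) σ

{-# OPTIONS --safe #-}
{-
Every D′ ∈ e(ℍ) satisfies the first-order sentences which say that the predicate meets every open
interval, that no finite union of images f i(D′) covers an open interval, and that distinct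
elements of D′ are not related by the f i. They hold in all H-structures, because the type of c⁺
(the formulas true on some interval (c , e)) is complete and non-algebraic in every model of T.

In 𝕄 the hypothesis on dcl makes the boundary points of an A-definable set lie in dcl(A), so
that a non-algebraic type over a small set is realized by a whole interval, in which both a
point of D′ and a point outside dcl(D′) can be found. It also makes the partial elementary maps
extendable by one element at a time while keeping the predicates matched: since dcl is trivial
and satisfies exchange, the only condition to maintain is that elements of the predicate which are
definable over the domain (or range) belong to it. A back-and-forth of length κ ends in an
automorphism of 𝕄 taking ℍ to D′.
-}
module Submission where

open import Defs
open import Axiom.ExcludedMiddle using (ExcludedMiddle)
open import Data.Bool.Base using (Bool)
open import Data.Empty using (⊥; ⊥-elim)
import Data.Empty.Polymorphic as Poly
open import Data.Fin.Base as Fin using (Fin; zero; suc; _↑ʳ_; _↑ˡ_)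
open import Data.Fin.Patterns using (0F; 1F; 2F; 3F; 4F)
import Data.Fin.Properties as Fin
open import Data.List.Base as List using (List; []; _∷_; _++_)
open import Data.List.Membership.Propositional using (_∈_)
open import Data.List.Membership.Propositional.Properties using (∈-++⁺ˡ; ∈-++⁺ʳ)
open import Data.List.Relation.Unary.All using (All; []; _∷_)
open import Data.List.Relation.Unary.Any using (here; there)
open import Data.Nat.Base as ℕ using (ℕ; zero; suc; _+_)
open import Data.Nat.Properties using (n<1+n; <⇒<′)
open import Data.Product.Base using (Σ-syntax; ∃; ∃-syntax; _×_; _,_; proj₁; proj₂; swap)
open import Data.Sum.Base as Sum using (_⊎_; inj₁; inj₂; [_,_]′)
import Data.Unit.Polymorphic as Poly
open import Data.Vec.Base as Vec using (Vec; []; _∷_; lookup; drop)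
open import Data.Vec.Properties using (lookup-map; lookup-++ˡ; lookup-++ʳ; tabulate∘lookup)
open import Data.Vec.Relation.Binary.Pointwise.Inductive as Pointwise using (Pointwise; []; _∷_)
import Data.Vec.Relation.Unary.All as VecAll
open VecAll using ([]; _∷_)
open import Function.Base using (_∘_; id; flip)
open import Function.Bundles using (Equivalence; Inverse; _↔_; mk⇔; mk↔ₛ′)
open import Induction.WellFounded using (Acc; acc)
open import Level using (Level; _⊔_; lift)
import Relation.Binary.Construct.Add.Extrema.Strict as Extrema
import Relation.Binary.Construct.Add.Supremum.Strict as Supremum
open import Relation.Binary.Definitions using (Tri; tri<; tri≈; tri>)
open import Relation.Binary.PropositionalEquality.Core using (_≡_; refl; sym; trans; cong; cong₂; subst)
open import Relation.Binary.Structures using (IsDenseLinearOrder; IsStrictTotalOrder)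
open import Relation.Nullary using (¬_; Dec; yes; no; does)
open import Relation.Nullary.Construct.Add.Extrema using (_±; [_]; ⊥±; ⊤±)
open import Relation.Unary using (Pred; U; ∅; _∪_; ｛_｝; _≐_)

-- The back-and-forth therefore reduces each type to a single instance of a sentence, and this is
-- the purpose of the interval. Saturation of `M` in L is applied twice, first to realize the type
-- at c, then to find d > c below all the neighbourhoods of c on which the formulas of the type stay
-- true; density and codensity are then used with just the two parameters c and d. Codensity is
-- first-order because triviality replaces dcl(D′) by finitely many 0-definable images together with
-- dcl(∅), and dcl(∅) is avoided by the type itself, not by the sentence. Triviality also carries
-- the construction through limits: an element depends on one parameter at a time, so nothing
-- becomes definable over a union of stages that is not definable over one of them.

private
  variable
    ℓ : Level
    n m h k : ℕ

infix 2 _⟺_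

_⟺_ : ∀ {a b} → Set a → Set b → Set (a ⊔ b)
A ⟺ B = (A → B) × (B → A)

-- Renaming of variables

module _ {L : Language ℓ} where

  mutual
    renT : (Fin n → Fin m) → Term L n → Term L m
    renT r (var i)    = var (r i)
    renT r (app g ts) = app g (renTs r ts)

    renTs : (Fin n → Fin m) → Vec (Term L n) k → Vec (Term L m) k
    renTs r []       = []
    renTs r (s ∷ ts) = renT r s ∷ renTs r ts

  ren : (Fin n → Fin m) → Formula L n → Formula L m
  ren r falsum     = falsum
  ren r (s ≈ s′)   = renT r s ≈ renT r s′
  ren r (rel R ts) = rel R (renTs r ts)
  ren r (φ ⇒ ψ)    = ren r φ ⇒ ren r ψ
  ren r (all φ)    = all (ren (Fin.lift 1 r) φ)

  module _ (N : Structure L) where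

    mutual
      eval-ren : (r : Fin n → Fin m) {ρ : Vec ∣ N ∣ n} {ρ′ : Vec ∣ N ∣ m} →
                 (∀ i → lookup ρ′ (r i) ≡ lookup ρ i) →
                 ∀ s → eval N (renT r s) ρ′ ≡ eval N s ρ
      eval-ren r eq (var i)    = eq i
      eval-ren r eq (app g ts) = cong (Structure.funcInt N g) (evals-ren r eq ts)

      evals-ren : (r : Fin n → Fin m) {ρ : Vec ∣ N ∣ n} {ρ′ : Vec ∣ N ∣ m} →
                  (∀ i → lookup ρ′ (r i) ≡ lookup ρ i) →
                  (ts : Vec (Term L n) k) → evals N (renTs r ts) ρ′ ≡ evals N ts ρ
      evals-ren r eq []       = refl
      evals-ren r eq (s ∷ ts) = cong₂ _∷_ (eval-ren r eq s) (evals-ren r eq ts)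

    sat-ren : (r : Fin n → Fin m) {ρ : Vec ∣ N ∣ n} {ρ′ : Vec ∣ N ∣ m} →
              (∀ i → lookup ρ′ (r i) ≡ lookup ρ i) →
              ∀ φ → Sat N (ren r φ) ρ′ ⟺ Sat N φ ρ
    sat-ren r eq falsum = id , id
    sat-ren r eq (s ≈ s′) =
      (λ p → trans (sym (eval-ren r eq s)) (trans p (eval-ren r eq s′))) ,
      (λ p → trans (eval-ren r eq s) (trans p (sym (eval-ren r eq s′))))
    sat-ren r eq (rel R ts) =
      subst (Structure.relInt N R) (evals-ren r eq ts) ,
      subst (Structure.relInt N R) (sym (evals-ren r eq ts))
    sat-ren r eq (φ ⇒ ψ) =
      (λ p x → proj₁ (sat-ren r eq ψ) (p (proj₂ (sat-ren r eq φ) x))) ,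
      (λ p x → proj₂ (sat-ren r eq ψ) (p (proj₁ (sat-ren r eq φ) x)))
    sat-ren r {ρ} {ρ′} eq (all φ) =
      (λ p x → proj₁ (sat-ren (Fin.lift 1 r) (eq⁺ x) φ) (p x)) ,
      (λ p x → proj₂ (sat-ren (Fin.lift 1 r) (eq⁺ x) φ) (p x))
      where
      eq⁺ : ∀ x i → lookup (x ∷ ρ′) (Fin.lift 1 r i) ≡ lookup (x ∷ ρ) i
      eq⁺ x zero    = refl
      eq⁺ x (suc i) = eq i

-- A syntax for first-order conditions whose interpretation ⟦_⟧ computes to the
-- intended type-theoretic statement; excluded middle makes it agree with Sat.
module _ (L : Language ℓ) where

  data Cond : ℕ → Set ℓ where
    atom      : Formula L h → Vec (Fin n) h → Cond n
    -- φ(xᵢ , ā), where ā is what remains of the environment after its first p entries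
    param     : ∀ p → Formula L (suc m) → Fin (p + m) → Cond (p + m)
    _==_      : Fin n → Fin n → Cond n
    not       : Cond n → Cond n
    _and_ _imp_ : Cond n → Cond n → Cond n
    ex al     : Cond (suc n) → Cond n
    ⋀         : (Fin k → Cond n) → Cond n

  infix  7 _==_
  infixr 6 _and_
  infixr 5 _imp_

param-vars : ∀ p → Fin (p + m) → Fin (suc m) → Fin (p + m)
param-vars p i zero    = i
param-vars p i (suc j) = p ↑ʳ j

module _ {L : Language ℓ} where

  ⟦_⟧ : Cond L n → (N : Structure L) → Vec ∣ N ∣ n → Set ℓ
  ⟦ atom φ vs ⟧   N ρ = Sat N φ (Vec.map (lookup ρ) vs)
  ⟦ param p φ i ⟧ N ρ = Sat N φ (lookup ρ i ∷ drop p ρ)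
  ⟦ i == j ⟧      N ρ = lookup ρ i ≡ lookup ρ j
  ⟦ not A ⟧       N ρ = ¬ ⟦ A ⟧ N ρ
  ⟦ A and B ⟧     N ρ = ⟦ A ⟧ N ρ × ⟦ B ⟧ N ρ
  ⟦ A imp B ⟧     N ρ = ⟦ A ⟧ N ρ → ⟦ B ⟧ N ρ
  ⟦ ex A ⟧        N ρ = ∃[ x ] ⟦ A ⟧ N (x ∷ ρ)
  ⟦ al A ⟧        N ρ = ∀ x → ⟦ A ⟧ N (x ∷ ρ)
  ⟦ ⋀ A ⟧         N ρ = ∀ i → ⟦ A i ⟧ N ρ

  conj : Formula L n → Formula L n → Formula L n
  conj φ ψ = neg (φ ⇒ neg ψ)

  bigConj : (Fin k → Formula L n) → Formula L n
  bigConj {k = zero}  φs = falsum ⇒ falsum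
  bigConj {k = suc k} φs = conj (φs zero) (bigConj (φs ∘ suc))

  compile : Cond L n → Formula L n
  compile (atom φ vs)   = ren (lookup vs) φ
  compile (param p φ i) = ren (param-vars p i) φ
  compile (i == j)      = var i ≈ var j
  compile (not A)       = neg (compile A)
  compile (A and B)     = conj (compile A) (compile B)
  compile (A imp B)     = compile A ⇒ compile B
  compile (ex A)        = neg (all (neg (compile A)))
  compile (al A)        = all (compile A)
  compile (⋀ A)         = bigConj (λ i → compile (A i))

  al* : Cond L n → Cond L 0
  al* {n = zero}  A = A
  al* {n = suc n} A = al* (al A)

  al*-intro : ∀ {N} (A : Cond L n) → (∀ ρ → ⟦ A ⟧ N ρ) → ⟦ al* A ⟧ N []
  al*-intro {n = zero}  A p = p []
  al*-intro {n = suc n} A p = al*-intro (al A) (λ ρ x → p (x ∷ ρ))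

  al*-elim : ∀ {N} (A : Cond L n) → ⟦ al* A ⟧ N [] → ∀ ρ → ⟦ A ⟧ N ρ
  al*-elim {n = zero}  A p []      = p
  al*-elim {n = suc n} A p (x ∷ ρ) = al*-elim (al A) p ρ x

lookup-drop : ∀ {a} {A : Set a} p (ρ : Vec A (p + m)) j →
              lookup ρ (p ↑ʳ j) ≡ lookup (drop p ρ) j
lookup-drop zero    ρ       j = refl
lookup-drop (suc p) (x ∷ ρ) j = lookup-drop p ρ j

-- Classical logic and the agreement of conditions with formulas

module Classical (em : ∀ {a} → ExcludedMiddle a) where

  dne : ∀ {a} {A : Set a} → ¬ ¬ A → A
  dne {A = A} ¬¬a with em {P = A}
  ... | yes a = a
  ... | no ¬a = ⊥-elim (¬¬a ¬a)

  ¬∀⇒∃¬ : ∀ {a b} {A : Set a} {B : A → Set b} → ¬ (∀ x → B x) → ∃[ x ] ¬ B x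
  ¬∀⇒∃¬ ¬∀ = dne (λ ¬∃ → ¬∀ (λ x → dne (λ ¬b → ¬∃ (x , ¬b))))

  ¬→⇒×¬ : ∀ {a b} {A : Set a} {B : Set b} → ¬ (A → B) → A × ¬ B
  ¬→⇒×¬ ¬f = dne (λ ¬a → ¬f (λ a → ⊥-elim (¬a a))) , (λ b → ¬f (λ _ → b))

  module _ {L : Language ℓ} (N : Structure L) where

    neg-elim : ∀ {φ : Formula L n} {ρ} → Sat N (neg φ) ρ → ¬ Sat N φ ρ
    neg-elim p x = Poly.⊥-elim (p x)

    neg-intro : ∀ {φ : Formula L n} {ρ} → ¬ Sat N φ ρ → Sat N (neg φ) ρ
    neg-intro p x = ⊥-elim (p x)

    conj-sat : ∀ (φ ψ : Formula L n) ρ → Sat N (conj φ ψ) ρ ⟺ (Sat N φ ρ × Sat N ψ ρ)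
    conj-sat φ ψ ρ =
      (λ p → dne (λ ¬q → neg-elim {φ = φ ⇒ neg ψ} p (λ x y → ⊥-elim (¬q (x , y))))) ,
      (λ (x , y) f → f x y)

    bigConj-sat : ∀ (φs : Fin k → Formula L n) ρ →
                  Sat N (bigConj φs) ρ ⟺ (∀ i → Sat N (φs i) ρ)
    bigConj-sat {k = zero}  φs ρ = (λ _ ()) , (λ _ x → x)
    bigConj-sat {k = suc k} φs ρ =
      (λ { p zero    → proj₁ (proj₁ (conj-sat (φs zero) (bigConj (φs ∘ suc)) ρ) p)
         ; p (suc i) → proj₁ (bigConj-sat (φs ∘ suc) ρ)
                         (proj₂ (proj₁ (conj-sat (φs zero) (bigConj (φs ∘ suc)) ρ) p)) i }) ,
      (λ p → proj₂ (conj-sat (φs zero) (bigConj (φs ∘ suc)) ρ)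
               (p zero , proj₂ (bigConj-sat (φs ∘ suc) ρ) (λ i → p (suc i))))

    compile-sat : ∀ (A : Cond L n) ρ → Sat N (compile A) ρ ⟺ ⟦ A ⟧ N ρ
    compile-sat (atom φ vs) ρ =
      sat-ren N (lookup vs) (λ i → sym (lookup-map i (lookup ρ) vs)) φ
    compile-sat (param p φ i) ρ = sat-ren N (param-vars p i) eq φ
      where
      eq : ∀ j → lookup ρ (param-vars p i j) ≡ lookup (lookup ρ i ∷ drop p ρ) j
      eq zero    = refl
      eq (suc j) = lookup-drop p ρ j
    compile-sat (i == j) ρ = id , id
    compile-sat (not A) ρ with compile-sat A ρ
    ... | to , from = (λ p x → neg-elim {φ = compile A} p (from x)) , (λ p x → ⊥-elim (p (to x)))
    compile-sat (A and B) ρ with compile-sat A ρ | compile-sat B ρ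
    ... | to , from | to′ , from′ =
      (λ p → to (proj₁ (proj₁ (conj-sat (compile A) (compile B) ρ) p)) ,
             to′ (proj₂ (proj₁ (conj-sat (compile A) (compile B) ρ) p))) ,
      (λ (x , y) → proj₂ (conj-sat (compile A) (compile B) ρ) (from x , from′ y))
    compile-sat (A imp B) ρ with compile-sat A ρ | compile-sat B ρ
    ... | to , from | to′ , from′ = (λ p x → to′ (p (from x))) , (λ p x → from′ (p (to x)))
    compile-sat (ex A) ρ =
      (λ p → dne (λ ¬q → neg-elim {φ = all (neg (compile A))} p
               (λ x y → ⊥-elim (¬q (x , proj₁ (compile-sat A (x ∷ ρ)) y))))) ,
      (λ (x , y) p → p x (proj₂ (compile-sat A (x ∷ ρ)) y))
    compile-sat (al A) ρ =
      (λ p x → proj₁ (compile-sat A (x ∷ ρ)) (p x)) ,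
      (λ p x → proj₂ (compile-sat A (x ∷ ρ)) (p x))
    compile-sat (⋀ A) ρ =
      (λ p i → proj₁ (compile-sat (A i) ρ) (proj₁ (bigConj-sat (λ i → compile (A i)) ρ) p i)) ,
      (λ p → proj₂ (bigConj-sat (λ i → compile (A i)) ρ) (λ i → proj₂ (compile-sat (A i) ρ) (p i)))

-- Dense orders and local constancy

record DenseOrder {X : Set ℓ} (_<_ : X → X → Set ℓ) : Set ℓ where
  field
    irrefl  : ∀ {x} → ¬ (x < x)
    <-trans : ∀ {x y z} → x < y → y < z → x < z
    tri     : ∀ x y → x < y ⊎ x ≡ y ⊎ y < x
    dense   : ∀ {x y} → x < y → ∃[ z ] x < z × z < y

flipOrder : {X : Set ℓ} {_<_ : X → X → Set ℓ} → DenseOrder _<_ → DenseOrder (flip _<_)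
flipOrder O = record
  { irrefl  = irrefl
  ; <-trans = λ p q → <-trans q p
  ; tri     = λ x y → Sum.map₂ (Sum.map₁ sym) (tri y x)
  ; dense   = λ p → let z , q , r = dense p in z , r , q
  }
  where open DenseOrder O

LocallyConstant : {X : Set ℓ} → (X → X → Set ℓ) → (X → Set ℓ) → X → Set ℓ
LocallyConstant _<_ P b =
  ∃[ c ] ∃[ d ] c < b × b < d × (∀ x → c < x → x < d → P x ⟺ P b)

module DenseOrderProperties (em : ∀ {a} → ExcludedMiddle a)
  {X : Set ℓ} {_<_ : X → X → Set ℓ} (O : DenseOrder _<_) where

  open DenseOrder O
  open Classical em

  asym : ∀ {x y} → x < y → ¬ (y < x)
  asym p q = irrefl (<-trans p q)

  ≮-trans : ∀ {x y z} → ¬ (y < x) → y < z → x < z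
  ≮-trans {x} {y} p q with tri x y
  ... | inj₁ r           = <-trans r q
  ... | inj₂ (inj₁ refl) = q
  ... | inj₂ (inj₂ r)    = ⊥-elim (p r)

  <-≮-trans : ∀ {x y z} → x < y → ¬ (z < y) → x < z
  <-≮-trans {y = y} {z} p q with tri y z
  ... | inj₁ r           = <-trans p r
  ... | inj₂ (inj₁ refl) = p
  ... | inj₂ (inj₂ r)    = ⊥-elim (q r)

  minimum : ∀ {c} x y → c < x → c < y → ∃[ z ] c < z × ¬ (x < z) × ¬ (y < z)
  minimum x y p q with tri x y
  ... | inj₁ r           = x , p , irrefl , asym r
  ... | inj₂ (inj₁ refl) = x , p , irrefl , irrefl
  ... | inj₂ (inj₂ r)    = y , q , asym r , irrefl

  avoid : ∀ S {c e} → c < e →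
          ∃[ e′ ] c < e′ × ¬ (e < e′) × (∀ {s} → s ∈ S → c < s → ¬ (s < e′))
  avoid [] {e = e} p = e , p , irrefl , λ ()
  avoid (s ∷ S) {c} p with avoid S p
  ... | e′ , q , r , f with em {P = c < s}
  ...   | no s≤c = e′ , q , r , λ { (here refl) u _ → s≤c u ; (there i) → f i }
  ...   | yes c<s with minimum s e′ c<s q
  ...     | z , c<z , z≤s , z≤e′ =
    z , c<z , (λ e<z → z≤e′ (≮-trans r e<z)) ,
    λ { (here refl) u v → z≤s v ; (there i) u v → f i u (<-≮-trans v z≤e′) }

  greatest : (Q : X → Set ℓ) (xs : List X) → ∀ {q} → Q q →
             ∃[ b ] Q b × ¬ (b < q) × (∀ {y} → y ∈ xs → Q y → ¬ (b < y))
  greatest Q [] {q} Qq = q , Qq , irrefl , λ ()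
  greatest Q (x ∷ xs) Qq with greatest Q xs Qq
  ... | b , Qb , q≤b , f with em {P = Q x × b < x}
  ...   | yes (Qx , b<x) =
    x , Qx , (λ x<q → q≤b (<-trans b<x x<q)) ,
    λ { (here refl) _ → irrefl ; (there i) Qy x<y → f i Qy (<-trans b<x x<y) }
  ...   | no ¬x = b , Qb , q≤b , λ { (here refl) Qy b<y → ¬x (Qy , b<y) ; (there i) → f i }

  top-list : ∃[ ts ] (∀ {b} → ¬ (∃[ d ] b < d) → b ∈ ts)
  top-list with em {P = ∃[ t ] ¬ (∃[ d ] t < d)}
  ... | no ¬t        = [] , λ ¬d → ⊥-elim (¬t (_ , ¬d))
  ... | yes (t , ¬d) = t ∷ [] , λ {b} ¬d′ → here (same b ¬d′ (tri b t))
    where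
    same : ∀ b → ¬ (∃[ d ] b < d) → b < t ⊎ b ≡ t ⊎ t < b → b ≡ t
    same b ¬d′ (inj₁ p)        = ⊥-elim (¬d′ (_ , p))
    same b ¬d′ (inj₂ (inj₁ p)) = p
    same b ¬d′ (inj₂ (inj₂ p)) = ⊥-elim (¬d (_ , p))

module Boundary (em : ∀ {a} → ExcludedMiddle a)
  {X : Set ℓ} {_<_ : X → X → Set ℓ} (O : DenseOrder _<_) (P : X → Set ℓ) where

  open DenseOrder O
  open DenseOrderProperties em O
  open DenseOrderProperties em (flipOrder O) using ()
    renaming (avoid to avoidˡ; minimum to maximum; top-list to bottom-list)
  open Classical em

  -- All that is kept of a decomposition into points and intervals is the list of endpoints, across
  -- which alone P can change. Local constancy allows such a list to be shortened one point at a
  -- time.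
  ControlledBy : List X → Set ℓ
  ControlledBy S = ∀ {x y} → x < y → (∀ {s} → s ∈ S → s < x ⊎ y < s) → P x ⟺ P y

  LC : X → Set ℓ
  LC = LocallyConstant _<_ P

  controlled⇒LC : ∀ S → ControlledBy S → ∀ {b c d} → c < b → b < d → ¬ (b ∈ S) → LC b
  controlled⇒LC S ctrl {b} c<b b<d b∉S with avoidˡ S c<b | avoid S b<d
  ... | c′ , c′<b , _ , f | d′ , b<d′ , _ , g = c′ , d′ , c′<b , b<d′ , near
    where
    near : ∀ x → c′ < x → x < d′ → P x ⟺ P b
    near x c′<x x<d′ with tri x b
    ... | inj₂ (inj₁ refl) = id , id
    ... | inj₁ x<b = ctrl x<b apart
      where
      apart : ∀ {s} → s ∈ S → s < x ⊎ b < s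
      apart {s} i with tri s x | tri s b
      ... | inj₁ p           | _                = inj₁ p
      ... | inj₂ (inj₁ refl) | _                = ⊥-elim (f i x<b c′<x)
      ... | inj₂ (inj₂ p)    | inj₁ q           = ⊥-elim (f i q (<-trans c′<x p))
      ... | inj₂ (inj₂ p)    | inj₂ (inj₁ refl) = ⊥-elim (b∉S i)
      ... | inj₂ (inj₂ p)    | inj₂ (inj₂ q)    = inj₂ q
    ... | inj₂ (inj₂ b<x) = proj₂ P⟺ , proj₁ P⟺
      where
      apart : ∀ {s} → s ∈ S → s < b ⊎ x < s
      apart {s} i with tri s x | tri s b
      ... | inj₂ (inj₂ p)    | _                = inj₂ p
      ... | inj₂ (inj₁ refl) | _                = ⊥-elim (g i b<x x<d′)
      ... | inj₁ p           | inj₂ (inj₂ q)    = ⊥-elim (g i q (<-trans p x<d′))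
      ... | inj₁ p           | inj₂ (inj₁ refl) = ⊥-elim (b∉S i)
      ... | inj₁ p           | inj₁ q           = inj₁ q
      P⟺ = ctrl b<x apart

  -- A greatest or least element has no two-sided neighbourhood and so counts as a boundary point;
  -- hence the two lists besides S.
  boundary-finite : ∀ S → ControlledBy S → ∃[ bs ] (∀ {b} → ¬ LC b → b ∈ bs)
  boundary-finite S ctrl = proj₁ top-list ++ proj₁ bottom-list ++ S , found
    where
    found : ∀ {b} → ¬ LC b → b ∈ proj₁ top-list ++ proj₁ bottom-list ++ S
    found {b} ¬lc with em {P = ∃[ d ] b < d} | em {P = ∃[ c ] c < b} | em {P = b ∈ S}
    ... | no ¬d         | _             | _      = ∈-++⁺ˡ (proj₂ top-list ¬d)
    ... | yes _         | no ¬c         | _      = ∈-++⁺ʳ (proj₁ top-list) (∈-++⁺ˡ (proj₂ bottom-list ¬c))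
    ... | yes _         | yes _         | yes i  = ∈-++⁺ʳ (proj₁ top-list) (∈-++⁺ʳ (proj₁ bottom-list) i)
    ... | yes (d , b<d) | yes (c , c<b) | no b∉S = ⊥-elim (¬lc (controlled⇒LC S ctrl c<b b<d b∉S))

  -- Definable connectedness: a controlling point at which P is locally constant
  -- can be dropped, so on [y , z] no controlling point is left.
  LC⇒constant : ∀ {y z} → y < z → (∀ b → ¬ (b < y) → ¬ (z < b) → LC b) →
                ∀ S → ControlledBy S → P y ⟺ P z
  LC⇒constant {y} {z} y<z lc S ctrl = go S (λ _ _ → ctrl) irrefl irrefl y<z λ ()
    where
    ControlledWithin : List X → Set ℓ
    ControlledWithin S = ∀ {x w} → ¬ (x < y) → ¬ (z < w) → x < w →
                         (∀ {s} → s ∈ S → s < x ⊎ w < s) → P x ⟺ P w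
    drop-point : ∀ s S → ControlledWithin (s ∷ S) → ControlledWithin S
    drop-point s S c {x} {w} y≤x w≤z x<w free with em {P = ¬ (s < x) × ¬ (w < s)}
    ... | no out = c y≤x w≤z x<w λ { (here refl) → apart ; (there i) → free i }
      where
      apart : s < x ⊎ w < s
      apart with em {P = s < x} | em {P = w < s}
      ... | yes p | _     = inj₁ p
      ... | no _  | yes q = inj₂ q
      ... | no p  | no q  = ⊥-elim (out (p , q))
    ... | yes (x≤s , s≤w) with lc s (λ s<y → y≤x (≮-trans x≤s s<y)) (λ z<s → w≤z (<-≮-trans z<s s≤w))
    ...   | u , v , u<s , s<v , near = (λ p → proj₁ right (proj₁ left p)) , (λ p → proj₂ left (proj₂ right p))
      where
      left : P x ⟺ P s
      left with tri x s
      ... | inj₂ (inj₁ refl) = id , id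
      ... | inj₂ (inj₂ s<x)  = ⊥-elim (x≤s s<x)
      -- `o′` is taken in (x , s) inside the neighbourhood of s: the interval from x to `o′` no
      -- longer contains s, and local constancy leads from `o′` to s.
      ... | inj₁ x<s with maximum x u x<s u<s
      ...   | o , o<s , x≤o , u≤o with dense o<s
      ...     | o′ , o<o′ , o′<s = (λ p → proj₁ near′ (proj₁ far p)) , (λ p → proj₂ far (proj₂ near′ p))
        where
        x<o′ = ≮-trans x≤o o<o′
        near′ = near o′ (≮-trans u≤o o<o′) (<-trans o′<s s<v)
        o′<w = <-≮-trans o′<s s≤w
        far : P x ⟺ P o′
        far = c y≤x (λ z<o′ → w≤z (<-trans z<o′ o′<w)) x<o′
          λ { (here refl) → inj₂ o′<s ; (there i) → [ inj₁ , (λ w<t → inj₂ (<-trans o′<w w<t)) ]′ (free i) }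
      right : P s ⟺ P w
      right with tri s w
      ... | inj₂ (inj₁ refl) = id , id
      ... | inj₂ (inj₂ w<s)  = ⊥-elim (s≤w w<s)
      ... | inj₁ s<w with minimum w v s<w s<v
      ...   | o , s<o , o≤w , o≤v with dense s<o
      ...     | o′ , s<o′ , o′<o = (λ p → proj₁ far (proj₂ near′ p)) , (λ p → proj₁ near′ (proj₂ far p))
        where
        o′<w = <-≮-trans o′<o o≤w
        near′ = near o′ (<-trans u<s s<o′) (<-≮-trans o′<o o≤v)
        x<o′ = ≮-trans x≤s s<o′
        far : P o′ ⟺ P w
        far = c (λ o′<y → y≤x (<-trans x<o′ o′<y)) w≤z o′<w
          λ { (here refl) → inj₁ s<o′ ; (there i) → [ (λ t<x → inj₁ (<-trans t<x x<o′)) , inj₂ ]′ (free i) }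
    go : ∀ S → ControlledWithin S → ControlledWithin []
    go []      c = c
    go (s ∷ S) c = go S (drop-point s S c)

-- O-minimality in the models of a theory

module Pieces (em : ∀ {a} → ExcludedMiddle a)
  {X : Set ℓ} {_<_ : X → X → Set ℓ} (O : DenseOrder _<_) where

  open DenseOrder O
  open DenseOrderProperties em O
  open Extrema _<_ using (_<±_; ⊥±<[_]; ⊥±<⊤±; [_]<⊤±) renaming ([_] to <[_])

  finitePart : X ± → List X
  finitePart ⊥±    = []
  finitePart ⊤±    = []
  finitePart [ x ] = x ∷ []

  endpoints : Piece X → List X
  endpoints (point x)      = x ∷ []
  endpoints (interval l u) = finitePart l ++ finitePart u

  module _ {x y : X} (x<y : x < y) where

    Apart : List X → Set ℓ
    Apart S = ∀ {s} → s ∈ S → s < x ⊎ y < s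

    above : ∀ l → Apart (finitePart l) → (l <± [ x ]) ⟺ (l <± [ y ])
    above ⊥±    _     = (λ _ → ⊥±<[ y ]) , (λ _ → ⊥±<[ x ])
    above ⊤±    _     = (λ ()) , (λ ())
    above [ l ] apart =
      (λ { <[ p ] → <[ <-trans p x<y ] }) ,
      (λ { <[ p ] → [ <[_] , (λ y<l → ⊥-elim (asym p y<l)) ]′ (apart (here refl)) })

    below : ∀ u → Apart (finitePart u) → ([ x ] <± u) ⟺ ([ y ] <± u)
    below ⊥±    _     = (λ { Supremum.[ () ] }) , (λ { Supremum.[ () ] })
    below ⊤±    _     = (λ _ → [ y ]<⊤±) , (λ _ → [ x ]<⊤±)
    below [ u ] apart =
      (λ { <[ p ] → [ (λ u<x → ⊥-elim (asym p u<x)) , <[_] ]′ (apart (here refl)) }) ,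
      (λ { <[ p ] → <[ <-trans x<y p ] })

    piece-constant : ∀ p → Apart (endpoints p) → InPiece _<_ x p ⟺ InPiece _<_ y p
    piece-constant (point z) apart with apart (here refl)
    ... | inj₁ z<x =
      (λ { (lift refl) → ⊥-elim (irrefl z<x) }) ,
      (λ { (lift refl) → ⊥-elim (asym x<y z<x) })
    ... | inj₂ y<z =
      (λ { (lift refl) → ⊥-elim (asym x<y y<z) }) ,
      (λ { (lift refl) → ⊥-elim (irrefl y<z) })
    piece-constant (interval l u) apart
      with above l (apart ∘ ∈-++⁺ˡ) | below u (apart ∘ ∈-++⁺ʳ (finitePart l))
    ... | to , from | to′ , from′ =
      (λ (p , q) → to p , to′ q) , (λ (p , q) → from p , from′ q)

    ⋃-constant : ∀ ps → Apart (List.concatMap endpoints ps) → ⋃ _<_ ps x ⟺ ⋃ _<_ ps y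
    ⋃-constant []       _     = (λ ()) , (λ ())
    ⋃-constant (p ∷ ps) apart
      with piece-constant p (apart ∘ ∈-++⁺ˡ) | ⋃-constant ps (apart ∘ ∈-++⁺ʳ (endpoints p))
    ... | to , from | to′ , from′ =
      (λ { (here i) → here (to i) ; (there i) → there (to′ i) }) ,
      (λ { (here i) → here (from i) ; (there i) → there (from′ i) })

module _ {L : Language ℓ} (lt : Language.Relation L 2) where

  infix 7 _<′_

  _<′_ : Fin n → Fin n → Cond L n
  i <′ j = atom (rel lt (var zero ∷ var (suc zero) ∷ [])) (i ∷ j ∷ [])

  _iff_ : Cond L n → Cond L n → Cond L n
  A iff B = (A imp B) and (B imp A)

  locallyConstant : ∀ p → Formula L (suc m) → Fin (p + m) → Cond L (p + m)
  locallyConstant p φ i = ex (ex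
    (1F <′ suc (suc i) and suc (suc i) <′ 0F and
     al (2F <′ 0F imp 0F <′ 1F imp
         (param (3 + p) φ zero iff param (3 + p) φ (suc (suc (suc i)))))))

  LC : (N : Structure L) → Formula L (suc m) → Vec ∣ N ∣ m → ∣ N ∣ → Set ℓ
  LC N φ ā = LocallyConstant (order lt N) (λ x → Sat N φ (x ∷ ā))

  -- The consequences of o-minimality that are first-order for each single formula,
  -- and hence hold in every model of the theory.
  record Tame (N : Structure L) : Set ℓ where
    private
      _<_ = order lt N
    field
      denseOrder    : DenseOrder _<_
      last-boundary : (φ : Formula L (suc m)) (ā : Vec ∣ N ∣ m) → ∀ {b} → ¬ LC N φ ā b →
                      ∃[ z ] ¬ LC N φ ā z × (∀ y → ¬ LC N φ ā y → ¬ (z < y))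
      next-boundary : (φ : Formula L (suc m)) (ā : Vec ∣ N ∣ m) → ∀ {b y} → ¬ LC N φ ā y → b < y →
                      ∃[ z ] b < z × ¬ LC N φ ā z × (∀ w → ¬ LC N φ ā w → b < w → ¬ (w < z))
      connected     : (φ : Formula L (suc m)) (ā : Vec ∣ N ∣ m) → ∀ {y z} → y < z →
                      (∀ b → ¬ (b < y) → ¬ (z < b) → LC N φ ā b) →
                      Sat N φ (y ∷ ā) ⟺ Sat N φ (z ∷ ā)

  -- `Cond` has no disjunction, so `triC` expresses trichotomy by implications from negations.
  irreflC transC triC denseC : Cond L 0
  irreflC = al (not (0F <′ 0F))
  transC  = al (al (al (2F <′ 1F imp 1F <′ 0F imp 2F <′ 0F)))
  triC    = al (al (not (1F <′ 0F) imp not (1F == 0F) imp 0F <′ 1F))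
  denseC  = al (al (1F <′ 0F imp ex (2F <′ 0F and 0F <′ 1F)))

  lastC nextC connectedC : Formula L (suc m) → Cond L m
  lastC φ = al (not (locallyConstant 1 φ 0F) imp
    ex (not (locallyConstant 2 φ 0F) and
        al (not (locallyConstant 3 φ 0F) imp not (1F <′ 0F))))
  nextC φ = al (al (not (locallyConstant 2 φ 0F) imp 1F <′ 0F imp
    ex (2F <′ 0F and not (locallyConstant 3 φ 0F) and
        al (not (locallyConstant 4 φ 0F) imp 3F <′ 0F imp not (0F <′ 1F)))))
  connectedC φ = al (al (1F <′ 0F imp
    al (not (0F <′ 2F) imp not (1F <′ 0F) imp locallyConstant 3 φ 0F) imp
    (param 2 φ 1F iff param 2 φ 0F)))

  module OMinimal (em : ∀ {a} → ExcludedMiddle a) (T : Theory L ℓ) (R : Structure L)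
    (omin : IsDenselyOrderedOMinimal lt R) (T≐ThR : T ≐ Th R) where

    open Classical em

    R-order : DenseOrder (order lt R)
    R-order = record
      { irrefl  = I.irrefl refl
      ; <-trans = I.trans
      ; tri     = λ x y → tri⊎ (I.compare x y)
      ; dense   = I.dense
      }
      where
      module I = IsDenseLinearOrder (IsDenselyOrderedOMinimal.isDenseLinearOrder omin)
      tri⊎ : ∀ {x y} → Tri (order lt R x y) (x ≡ y) (order lt R y x) →
             order lt R x y ⊎ x ≡ y ⊎ order lt R y x
      tri⊎ (tri< p _ _) = inj₁ p
      tri⊎ (tri≈ _ p _) = inj₂ (inj₁ p)
      tri⊎ (tri> _ _ p) = inj₂ (inj₂ p)

    module _ (φ : Formula L (suc m)) (ā : Vec ∣ R ∣ m) where
      open Boundary em R-order (λ x → Sat R φ (x ∷ ā))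

      controlled : ∃[ S ] ControlledBy S
      controlled with IsDenselyOrderedOMinimal.oMinimal omin (m , φ , ā)
      ... | ps , to , from = List.concatMap endpoints ps , λ x<y apart →
        let to′ , from′ = ⋃-constant x<y ps apart
        in (λ p → from (to′ (to p))) , (λ p → from (from′ (to p)))
        where open Pieces em R-order

    -- The boundary of a definable set of R is covered by a finite list, which yields a last
    -- boundary point and, in the reversed order, a first one after b.
    R-tame : Tame R
    R-tame = record
      { denseOrder = R-order
      ; last-boundary = λ φ ā bd →
          let bs , fin = finite φ ā
              z , bdz , _ , max = greatest (λ x → ¬ LC R φ ā x) bs bd
          in z , bdz , λ y bdy → max (fin bdy) bdy
      ; next-boundary = λ φ ā {b} bdy b<y →
          let bs , fin = finite φ ā
              z , (bdz , b<z) , _ , min = least (λ x → ¬ LC R φ ā x × order lt R b x) bs (bdy , b<y)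
          in z , b<z , bdz , λ w bdw b<w → min (fin bdw) (bdw , b<w)
      ; connected = λ φ ā y<z lc →
          let S , ctrl = controlled φ ā
          in Boundary.LC⇒constant em R-order _ y<z lc S ctrl
      }
      where
      open DenseOrderProperties em R-order using (greatest)
      open DenseOrderProperties em (flipOrder R-order) using () renaming (greatest to least)
      finite : (φ : Formula L (suc m)) (ā : Vec ∣ R ∣ m) → ∃[ bs ] (∀ {b} → ¬ LC R φ ā b → b ∈ bs)
      finite φ ā = let S , ctrl = controlled φ ā in Boundary.boundary-finite em R-order _ S ctrl

    R-model : R ⊨ T
    R-model σ = proj₁ T≐ThR

    -- T decides every sentence: one that fails in R has its negation in T, so it cannot hold in N.
    complete : ∀ {N N′} → N ⊨ T → N′ ⊨ T → ∀ σ → Th N σ → Th N′ σ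
    complete {N} {N′} N⊨T N′⊨T σ p with em {P = Th R σ}
    ... | yes q = N′⊨T σ (proj₂ T≐ThR {σ} q)
    ... | no ¬q = ⊥-elim (neg-elim N {φ = σ}
                    (N⊨T (neg σ) (proj₂ T≐ThR {neg σ} (neg-intro R {φ = σ} ¬q))) p)

    transfer : ∀ {N N′} → N ⊨ T → N′ ⊨ T → (A : Cond L n) →
               (∀ ρ → ⟦ A ⟧ N ρ) → ∀ ρ → ⟦ A ⟧ N′ ρ
    transfer {N = N} {N′} N⊨T N′⊨T A p = al*-elim A (proj₁ (compile-sat N′ (al* A) [])
      (complete N⊨T N′⊨T (compile (al* A)) (proj₂ (compile-sat N (al* A) []) (al*-intro A p))))

    tame : ∀ {N} → N ⊨ T → Tame N
    tame {N} N⊨T = record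
      { denseOrder = record
        { irrefl  = λ {x} → fromR irreflC (λ { [] x → irrefl }) [] x
        ; <-trans = λ {x} {y} {z} → fromR transC (λ { [] x y z → <-trans }) [] x y z
        ; tri     = λ x y → tri′ (fromR triC triR [] x y)
        ; dense   = λ {x} {y} → fromR denseC (λ { [] x y → dense }) [] x y
        }
      ; last-boundary = λ φ ā {b} → fromR (lastC φ) (λ ā b → Tame.last-boundary R-tame φ ā) ā b
      ; next-boundary = λ φ ā {b} {y} → fromR (nextC φ) (λ ā b y → Tame.next-boundary R-tame φ ā) ā b y
      ; connected     = λ φ ā {y} {z} → fromR (connectedC φ) (λ ā y z → Tame.connected R-tame φ ā) ā y z
      }
      where
      open DenseOrder R-order
      fromR = λ {n} → transfer {n = n} R-model N⊨T
      triR : ∀ ρ → ⟦ triC ⟧ R ρ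
      triR [] x y x≮y x≢y with tri x y
      ... | inj₁ p        = ⊥-elim (x≮y p)
      ... | inj₂ (inj₁ p) = ⊥-elim (x≢y p)
      ... | inj₂ (inj₂ p) = p
      tri′ : ∀ {a b c} {A : Set a} {B : Set b} {C : Set c} → (¬ A → ¬ B → C) → A ⊎ B ⊎ C
      tri′ {A = A} {B} f with em {P = A} | em {P = B}
      ... | yes p | _     = inj₁ p
      ... | no _  | yes p = inj₂ (inj₁ p)
      ... | no p  | no q  = inj₂ (inj₂ (f p q))

-- Germs to the right of a point, and predicates resembling H

module RightGerm (em : ∀ {a} → ExcludedMiddle a) {L : Language ℓ} (lt : Language.Relation L 2)
  (N : Structure L) (tame : Tame lt N) where

  open Classical em
  open Tame tame
  open DenseOrder denseOrder
  open DenseOrderProperties em denseOrder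

  private
    _<_ = order lt N

  Eventually : ∣ N ∣ → Pred (ParamFormula N) ℓ
  Eventually c (m , φ , ā) = ∃[ e ] c < e × (∀ x → c < x → x < e → Sat N φ (x ∷ ā))

  boundary-free : (φ : Formula L (suc m)) (ā : Vec ∣ N ∣ m) → ∀ {c e} → c < e →
                  ∃[ e′ ] c < e′ × (∀ b → c < b → b < e′ → LC lt N φ ā b)
  boundary-free φ ā {c} {e} c<e with em {P = ∃[ y ] ¬ LC lt N φ ā y × c < y}
  ... | no ¬bd = e , c<e , λ b c<b _ → dne (λ ¬lc → ¬bd (b , ¬lc , c<b))
  ... | yes (y , bdy , c<y) with next-boundary φ ā bdy c<y
  ...   | z , c<z , _ , least = z , c<z , λ b c<b b<z → dne (λ ¬lc → least b ¬lc c<b b<z)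

  constant-between : (φ : Formula L (suc m)) (ā : Vec ∣ N ∣ m) → ∀ {c e} →
                     (∀ b → c < b → b < e → LC lt N φ ā b) →
                     ∀ {x y} → c < x → x < e → c < y → y < e → Sat N φ (x ∷ ā) → Sat N φ (y ∷ ā)
  constant-between φ ā lc {x} {y} c<x x<e c<y y<e with tri x y
  ... | inj₁ x<y = proj₁ (connected φ ā x<y (λ b x≤b b≤y → lc b (<-≮-trans c<x x≤b) (≮-trans b≤y y<e)))
  ... | inj₂ (inj₁ refl) = id
  ... | inj₂ (inj₂ y<x) = proj₂ (connected φ ā y<x (λ b y≤b b≤x → lc b (<-≮-trans c<y y≤b) (≮-trans b≤x x<e)))

  -- Up to the next boundary point after c the truth value is constant, so a single test point w
  -- decides between the formula and its negation.
  germ : ∀ φ {c e} → c < e → Eventually c φ ⊎ Eventually c (negP N φ)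
  germ (m , φ , ā) c<e with boundary-free φ ā c<e
  ... | e′ , c<e′ , lc with dense c<e′
  ...   | w , c<w , w<e′ with em {P = Sat N φ (w ∷ ā)}
  ...     | yes p = inj₁ (e′ , c<e′ , λ x c<x x<e′ → constant-between φ ā lc c<w w<e′ c<x x<e′ p)
  ...     | no ¬p = inj₂ (e′ , c<e′ , λ x c<x x<e′ → neg-intro N {φ = φ}
                      (λ q → ¬p (constant-between φ ā lc c<x x<e′ c<w w<e′ q)))

  module _ (A : Pred ∣ N ∣ ℓ) (c : ∣ N ∣) where

    RightType : Pred (ParamFormula N) ℓ
    RightType φ = Over N A φ × Eventually c φ

    eventually-all : ∀ {e φs} → c < e → All RightType φs →
                     ∃[ e′ ] c < e′ × (∀ x → c < x → x < e′ → All (λ φ → Solutions N φ x) φs)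
    eventually-all {e} c<e [] = e , c<e , λ _ _ _ → []
    eventually-all c<e ((_ , e₁ , c<e₁ , p) ∷ ps) with eventually-all c<e ps
    ... | e₂ , c<e₂ , q with minimum e₁ e₂ c<e₁ c<e₂
    ...   | e₃ , c<e₃ , e₃≤e₁ , e₃≤e₂ =
      e₃ , c<e₃ , λ x c<x x<e₃ → p x c<x (<-≮-trans x<e₃ e₃≤e₁) ∷ q x c<x (<-≮-trans x<e₃ e₃≤e₂)

    rightType-isType : ∀ {e} → c < e → IsType N A RightType
    rightType-isType c<e = record
      { over        = proj₁
      ; satisfiable = λ ps →
          let e′ , c<e′ , p = eventually-all c<e ps
              x , c<x , x<e′ = dense c<e′
          in x , p x c<x x<e′
      ; complete    = λ φ A-φ → Sum.map (A-φ ,_) (A-φ ,_) (germ φ c<e)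
      }

    -- An interval starting at c can be shortened until it contains none of finitely many given
    -- points, and density still leaves a point in it.
    rightType-nonAlgebraic : NonAlgebraic N RightType
    rightType-nonAlgebraic (_ , e , c<e , p) (S , sols) with avoid S c<e
    ... | e′ , c<e′ , e′≤e , f with dense c<e′
    ...   | x , c<x , x<e′ = f (sols (p x c<x (<-≮-trans x<e′ e′≤e))) c<x x<e′

    rightType-> : ∀ {e x} → A c → c < e → Realizes N x RightType → c < x
    rightType-> {e} {x} Ac c<e real = proj₁ (compile-sat N (_<′_ lt 1F 0F) (x ∷ c ∷ []))
      (real {1 , compile (_<′_ lt 1F 0F) , c ∷ []} ((Ac ∷ []) , e , c<e ,
        λ y c<y _ → proj₂ (compile-sat N (_<′_ lt 1F 0F) (y ∷ c ∷ [])) c<y))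

    rightType-< : ∀ {e x} → A e → c < e → Realizes N x RightType → x < e
    rightType-< {e} {x} Ae c<e real = proj₁ (compile-sat N (_<′_ lt 0F 1F) (x ∷ e ∷ []))
      (real {1 , compile (_<′_ lt 0F 1F) , e ∷ []} ((Ae ∷ []) , e , c<e ,
        λ y _ y<e → proj₂ (compile-sat N (_<′_ lt 0F 1F) (y ∷ e ∷ [])) y<e))

-- Formulas of L read in the expanded language

module _ {L : Language ℓ} where

  mutual
    liftT : Term L n → Term (L +H) n
    liftT (var i)    = var i
    liftT (app g ts) = app g (liftTs ts)

    liftTs : Vec (Term L n) k → Vec (Term (L +H) n) k
    liftTs []       = []
    liftTs (s ∷ ts) = liftT s ∷ liftTs ts

  liftF : Formula L n → Formula (L +H) n
  liftF falsum     = falsum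
  liftF (s ≈ s′)   = liftT s ≈ liftT s′
  liftF (rel R ts) = rel (old R) (liftTs ts)
  liftF (φ ⇒ ψ)    = liftF φ ⇒ liftF ψ
  liftF (all φ)    = all (liftF φ)

  module _ (N : Structure L) (D : Pred ∣ N ∣ ℓ) where

    mutual
      eval-lift : ∀ (s : Term L n) ρ → eval (expand N D) (liftT s) ρ ≡ eval N s ρ
      eval-lift (var i)    ρ = refl
      eval-lift (app g ts) ρ = cong (Structure.funcInt N g) (evals-lift ts ρ)

      evals-lift : ∀ (ts : Vec (Term L n) k) ρ → evals (expand N D) (liftTs ts) ρ ≡ evals N ts ρ
      evals-lift []       ρ = refl
      evals-lift (s ∷ ts) ρ = cong₂ _∷_ (eval-lift s ρ) (evals-lift ts ρ)

    sat-lift : ∀ (φ : Formula L n) ρ → Sat (expand N D) (liftF φ) ρ ⟺ Sat N φ ρ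
    sat-lift falsum     ρ = id , id
    sat-lift (s ≈ s′)   ρ =
      (λ p → trans (sym (eval-lift s ρ)) (trans p (eval-lift s′ ρ))) ,
      (λ p → trans (eval-lift s ρ) (trans p (sym (eval-lift s′ ρ))))
    sat-lift (rel R ts) ρ =
      subst (Structure.relInt N R) (evals-lift ts ρ) ,
      subst (Structure.relInt N R) (sym (evals-lift ts ρ))
    sat-lift (φ ⇒ ψ)    ρ =
      (λ p x → proj₁ (sat-lift ψ ρ) (p (proj₂ (sat-lift φ ρ) x))) ,
      (λ p x → proj₂ (sat-lift ψ ρ) (p (proj₁ (sat-lift φ ρ) x)))
    sat-lift (all φ)    ρ =
      (λ p x → proj₁ (sat-lift φ (x ∷ ρ)) (p x)) ,
      (λ p x → proj₂ (sat-lift φ (x ∷ ρ)) (p x))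

module Graph {L : Language ℓ} (M : Structure L) (f : Fin k → ∣ M ∣ → ∣ M ∣)
  (f-def : ∀ i → IsZeroDefinable M (f i)) where

  φ : Fin k → Formula L 2
  φ i = proj₁ (f-def i)

  graph : ∀ i {x y} → Sat M (φ i) (x ∷ y ∷ []) → f i x ≡ y
  graph i = Equivalence.to (proj₂ (f-def i) _ _)

  graph⁻¹ : ∀ i {x y} → f i x ≡ y → Sat M (φ i) (x ∷ y ∷ [])
  graph⁻¹ i = Equivalence.from (proj₂ (f-def i) _ _)

-- The part of genericity that sentences can express. `codense` speaks only of images under the
-- `f i`: for x outside dcl(∅), triviality turns this into x ∉ dcl(D). For the same reason
-- `independent` compares only two elements of D at a time.
record IsGeneric {L : Language ℓ} (lt : Language.Relation L 2) (M : Structure L)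
  (f : Fin k → ∣ M ∣ → ∣ M ∣) (D : Pred ∣ M ∣ ℓ) : Set ℓ where
  private
    _<_ = order lt M
  field
    dense          : ∀ {c d} → c < d → ∃[ x ] D x × c < x × x < d
    codense        : ∀ {c d} → c < d →
                     ∃[ x ] c < x × x < d × (∀ y → D y → ∀ i → ¬ (f i y ≡ x))
    transcendental : ∀ {h} → D h → ¬ dcl M ∅ h
    independent    : ∀ {h h′} → D h → D h′ → ∀ i → f i h′ ≡ h → h′ ≡ h

-- Genericity as a set of sentences true in all H-structures

module _ {L : Language ℓ} (lt : Language.Relation L 2) where

  private
    _≺_ : Fin n → Fin n → Cond (L +H) n
    _≺_ = _<′_ (old lt)

    inH : Fin n → Cond (L +H) n
    inH i = atom (rel new (var zero ∷ [])) (i ∷ [])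

  densityC : Cond (L +H) 0
  densityC = al (al (1F ≺ 0F imp ex (inH 0F and 2F ≺ 0F and 0F ≺ 1F)))

  codensityC : (Fin k → Formula L 2) → Cond (L +H) 0
  codensityC φ = al (al (1F ≺ 0F imp
    ex (2F ≺ 0F and 0F ≺ 1F and al (inH 0F imp ⋀ λ i → not (atom (liftF (φ i)) (0F ∷ 1F ∷ []))))))

  transcendenceC : Formula L 1 → Cond (L +H) 0
  transcendenceC θ = al (inH 0F imp
    not (atom (liftF θ) (0F ∷ []) and al (atom (liftF θ) (0F ∷ []) imp 1F == 0F)))

  independenceC : Formula L 2 → Cond (L +H) 0
  independenceC φ = al (al (inH 1F imp inH 0F imp atom (liftF φ) (0F ∷ 1F ∷ []) imp 0F == 1F))

  functionalC : Formula L 2 → Cond L 0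
  functionalC φ = al (al (al (atom φ (2F ∷ 1F ∷ []) imp atom φ (2F ∷ 0F ∷ []) imp 1F == 0F)))

  module Generic (em : ∀ {a} → ExcludedMiddle a) (T : Theory L ℓ) (R : Structure L)
    (omin : IsDenselyOrderedOMinimal lt R) (T≐ThR : T ≐ Th R)
    (M : Structure L) (M⊨T : M ⊨ T)
    (f : Fin k → ∣ M ∣ → ∣ M ∣) (f-def : ∀ i → IsZeroDefinable M (f i)) where

    open Classical em
    open OMinimal lt em T R omin T≐ThR
    open Graph M f f-def

    module _ {N : Structure L} {H : Pred ∣ N ∣ ℓ} (isH : IsHStructure T N H) where

      open IsHStructure isH
      open RightGerm em lt N (tame model)

      H-dense : ⟦ densityC ⟧ (expand N H) []
      H-dense c d c<d
        with density (c ∷ d ∷ []) (RightType _ c) (rightType-isType _ c c<d)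
               (λ {φ} → rightType-nonAlgebraic _ c {φ})
      ... | x , Hx , real =
        x , Hx ,
        rightType-> _ c (here refl) c<d (λ {φ} → real {φ}) ,
        rightType-< _ c (there (here refl)) c<d (λ {φ} → real {φ})

      -- The functions `f i` exist on `M` only. In another model of T there is just the formula
      -- `φ i`, whose functionality is a sentence and passes over by completeness.
      φ-functional : ∀ i {x y z} → Sat N (φ i) (x ∷ y ∷ []) → Sat N (φ i) (x ∷ z ∷ []) → y ≡ z
      φ-functional i {x} {y} {z} = transfer M⊨T model (functionalC (φ i))
        (λ { [] _ _ _ p q → trans (sym (graph i p)) (graph i q) }) [] x y z

      φ-acl : ∀ (A : Pred ∣ N ∣ ℓ) i {x y} → A x → Sat N (φ i) (x ∷ y ∷ []) → acl N A y
      φ-acl A i {x} {y} Ax p =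
        (1 , compile image , x ∷ []) , (Ax ∷ []) ,
        (y ∷ [] , λ q → here (φ-functional i (proj₁ (compile-sat N image (_ ∷ _ ∷ [])) q) p)) ,
        proj₂ (compile-sat N image (_ ∷ _ ∷ [])) p
        where
        image : Cond L 2
        image = atom (φ i) (1F ∷ 0F ∷ [])

      -- `extension` keeps x outside acl({c , d} ∪ H), which contains every `φ i`-image of a point
      -- of H.
      H-codense : ⟦ codensityC φ ⟧ (expand N H) []
      H-codense c d c<d
        with extension (c ∷ d ∷ []) (RightType _ c) (rightType-isType _ c c<d)
               (λ {φ} → rightType-nonAlgebraic _ c {φ})
      ... | x , x∉acl , real =
        x ,
        rightType-> _ c (here refl) c<d (λ {φ} → real {φ}) ,
        rightType-< _ c (there (here refl)) c<d (λ {φ} → real {φ}) ,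
        λ y Hy i p → x∉acl (φ-acl _ i (inj₂ Hy) (proj₁ (sat-lift N H (φ i) (_ ∷ _ ∷ [])) p))

      H-transcendental : ∀ θ → ⟦ transcendenceC θ ⟧ (expand N H) []
      H-transcendental θ h Hh (p , unique) = independent h Hh
        ((0 , θ , []) , [] ,
         (h ∷ [] , λ q → here (sym (unique _ (proj₂ (sat-lift N H θ (_ ∷ [])) q)))) ,
         proj₁ (sat-lift N H θ (h ∷ [])) p)

      H-independent : ∀ i → ⟦ independenceC (φ i) ⟧ (expand N H) []
      H-independent i h h′ Hh Hh′ p = dne (λ h′≢h → independent h Hh
        (φ-acl _ i (Hh′ , λ h≡h′ → h′≢h (sym h≡h′)) (proj₁ (sat-lift N H (φ i) (_ ∷ _ ∷ [])) p)))

    generic : ∀ {D} → expand M D ⊨ Tindep T → IsGeneric lt M f D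
    generic {D} D⊨ = record
      { dense          = λ {c} {d} → holds densityC H-dense c d
      ; codense        = λ {c} {d} c<d →
          let x , c<x , x<d , p = holds (codensityC φ) H-codense c d c<d
          in x , c<x , x<d , λ y Dy i q → p y Dy i (proj₂ (sat-lift M D (φ i) (_ ∷ _ ∷ [])) (graph⁻¹ i q))
      -- A formula over ∅ has an empty parameter vector, so it is one of the θ of `transcendenceC`.
      ; transcendental = λ { {h} Dh ((zero , θ , []) , _ , unique , here′) →
          holds (transcendenceC θ) (λ isH → H-transcendental isH θ) h Dh
            (proj₂ (sat-lift M D θ (h ∷ [])) (here′ refl) ,
             λ x p → unique (proj₁ (sat-lift M D θ (x ∷ [])) p))
                           ; _ ((suc _ , _ , _ ∷ _) , (() ∷ _) , _) }
      ; independent    = λ {h} {h′} Dh Dh′ i p →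
          holds (independenceC (φ i)) (λ isH → H-independent isH i) h h′ Dh Dh′
            (proj₂ (sat-lift M D (φ i) (_ ∷ _ ∷ [])) (graph⁻¹ i p))
      }
      where
      holds : ∀ A → (∀ {N H} → IsHStructure T N H → ⟦ A ⟧ (expand N H) []) → ⟦ A ⟧ (expand M D) []
      holds A p = proj₁ (compile-sat (expand M D) A [])
        (D⊨ (compile A) (λ N H isH → proj₂ (compile-sat (expand N H) A []) (p isH)))

-- Trivial definable closure

module Trivial (em : ∀ {a} → ExcludedMiddle a) {L : Language ℓ} (lt : Language.Relation L 2)
  (M : Structure L) (tame : Tame lt M)
  (f : Fin k → ∣ M ∣ → ∣ M ∣) (f-def : ∀ i → IsZeroDefinable M (f i))
  (trivial : ∀ (A : Pred ∣ M ∣ ℓ) →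
    dcl M A ≐ ((λ b → ∃[ i ] ∃[ a ] A a × f i a ≡ b) ∪ dcl M ∅)) where

  open Classical em
  open Tame tame
  open DenseOrder denseOrder
  open DenseOrderProperties em denseOrder
  open DenseOrderProperties em (flipOrder denseOrder) using () renaming (minimum to maximum)
  open Graph M f f-def public

  private
    _<_ = order lt M

    _≺_ : Fin n → Fin n → Cond L n
    _≺_ = _<′_ lt

  dcl-intro : ∀ {p} {A : Pred ∣ M ∣ p} (C : Cond L (suc m)) {ā b} → VecAll.All A ā →
              ⟦ C ⟧ M (b ∷ ā) → (∀ x → ⟦ C ⟧ M (x ∷ ā) → x ≡ b) → dcl M A b
  dcl-intro C {ā} A-ā p unique =
    (_ , compile C , ā) , A-ā ,
    (λ q → sym (unique _ (proj₁ (compile-sat M C _) q))) ,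
    (λ { refl → proj₂ (compile-sat M C _) p })

  dcl-mono : ∀ {p q} {A : Pred ∣ M ∣ p} {B : Pred ∣ M ∣ q} →
             (∀ {x} → A x → B x) → ∀ {b} → dcl M A b → dcl M B b
  dcl-mono A⊆B (θ , A-θ , unique) = θ , VecAll.map A⊆B A-θ , unique

  dcl-∅ : ∀ {p} {A : Pred ∣ M ∣ p} {b} → dcl M ∅ b → dcl M A b
  dcl-∅ = dcl-mono (λ ())

  dcl-refl : ∀ {p} {A : Pred ∣ M ∣ p} {a} → A a → dcl M A a
  dcl-refl Aa = dcl-intro (0F == 1F) (Aa ∷ []) refl (λ _ → id)

  dcl-split : ∀ {A : Pred ∣ M ∣ ℓ} {b} → dcl M A b →
              (∃[ i ] ∃[ a ] A a × f i a ≡ b) ⊎ dcl M ∅ b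
  dcl-split {A} = proj₁ (trivial A)

  dcl-image : ∀ {A : Pred ∣ M ∣ ℓ} i {a} → A a → dcl M A (f i a)
  dcl-image {A} i Aa = proj₂ (trivial A) (inj₁ (i , _ , Aa , refl))

  dcl-closed : ∀ {A : Pred ∣ M ∣ ℓ} i {y} → dcl M A y → dcl M A (f i y)
  dcl-closed i {y} ((m , θ , ā) , A-ā , unique , here′) =
    dcl-intro (ex (param 2 θ 0F and atom (φ i) (0F ∷ 1F ∷ []))) A-ā
      (y , here′ refl , graph⁻¹ i refl)
      (λ x (z , p , q) → trans (sym (graph i q)) (cong (f i) (sym (unique p))))

  -- By triviality z depends on a single b ∈ B, so it is enough that dcl(A) is closed under each
  -- `f i`.
  dcl-trans : ∀ {A B : Pred ∣ M ∣ ℓ} → (∀ {a} → B a → dcl M A a) →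
              ∀ {z} → dcl M B z → dcl M A z
  dcl-trans B⊆dclA p with dcl-split p
  ... | inj₁ (i , b , Bb , refl) = dcl-closed i (B⊆dclA Bb)
  ... | inj₂ q                   = dcl-∅ q

  -- Triviality makes dcl distribute over unions: the one parameter on which y depends lies in A or
  -- is x.
  dcl-∪ : ∀ {A : Pred ∣ M ∣ ℓ} {x y} → dcl M (A ∪ ｛ x ｝) y → dcl M A y ⊎ dcl M ｛ x ｝ y
  dcl-∪ p with dcl-split p
  ... | inj₁ (i , a , inj₁ Aa , refl) = inj₁ (dcl-image i Aa)
  ... | inj₁ (i , a , inj₂ x≡a , refl) = inj₂ (dcl-image i x≡a)
  ... | inj₂ q                         = inj₁ (dcl-∅ q)

  dcl-trans-∅ : ∀ {x z} → dcl M ∅ x → dcl M ｛ x ｝ z → dcl M ∅ z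
  dcl-trans-∅ {x} p q with dcl-split {A = λ _ → Poly.⊥} (dcl-trans {B = ｛ x ｝} (λ { refl → dcl-∅ p }) q)
  ... | inj₁ (_ , _ , () , _)
  ... | inj₂ r = r

  -- If b ∉ dcl(A) were a boundary point of φ(·,ā), then so would be its successors among
  -- the boundary points. Over A each of them is interdefinable with the next one, so by
  -- triviality all of them belong to {f₁(b), …, f_k(b)}.
  module BoundaryChain (A : Pred ∣ M ∣ ℓ) (θ : Formula L (suc m)) {ā : Vec ∣ M ∣ m}
    (A-ā : VecAll.All A ā) where

    Bd : ∣ M ∣ → Set ℓ
    Bd x = ¬ LC lt M θ ā x

    next : ∀ x → Bd x → ¬ dcl M A x → ∃[ y ] x < y × Bd y × ¬ dcl M A y × dcl M ｛ x ｝ y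
    next x bdx x∉ with last-boundary θ ā bdx
    ... | z , bdz , last with tri x z
    ...   | inj₂ (inj₂ z<x)  = ⊥-elim (last x bdx z<x)
    -- Here x is itself the last boundary point, a description over A.
    ...   | inj₂ (inj₁ refl) = ⊥-elim (x∉ (dcl-intro
      (not (locallyConstant lt 1 θ 0F) and al (not (locallyConstant lt 2 θ 0F) imp not (1F ≺ 0F)))
      A-ā (bdz , last) same))
      where
      same : ∀ w → Bd w × (∀ y → Bd y → ¬ (w < y)) → w ≡ z
      same w (bdw , last′) with tri w z
      ... | inj₁ p        = ⊥-elim (last′ z bdz p)
      ... | inj₂ (inj₁ p) = p
      ... | inj₂ (inj₂ p) = ⊥-elim (last w bdw p)
    ...   | inj₁ x<z with next-boundary θ ā bdz x<z
    ...     | y , x<y , bdy , least =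
      y , x<y , bdy , y∉ , [ (λ p → ⊥-elim (y∉ p)) , id ]′ (dcl-∪ y∈)
      where
      y∈ : dcl M (A ∪ ｛ x ｝) y
      y∈ = dcl-intro
        (1F ≺ 0F and not (locallyConstant lt 2 θ 0F) and
         al (not (locallyConstant lt 3 θ 0F) imp 2F ≺ 0F imp not (0F ≺ 1F)))
        (inj₂ refl ∷ VecAll.map inj₁ A-ā) (x<y , bdy , least) same
        where
        same : ∀ w → x < w × Bd w × (∀ v → Bd v → x < v → ¬ (v < w)) → w ≡ y
        same w (x<w , bdw , least′) with tri w y
        ... | inj₁ p        = ⊥-elim (least w bdw x<w p)
        ... | inj₂ (inj₁ p) = p
        ... | inj₂ (inj₂ p) = ⊥-elim (least′ y bdy x<y p)
      x∈ : dcl M (A ∪ ｛ y ｝) x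
      x∈ = dcl-intro
        (0F ≺ 1F and not (locallyConstant lt 2 θ 0F) and
         al (not (locallyConstant lt 3 θ 0F) imp 1F ≺ 0F imp not (0F ≺ 2F)))
        (inj₂ refl ∷ VecAll.map inj₁ A-ā) (x<y , bdx , least) same
        where
        same : ∀ w → w < y × Bd w × (∀ v → Bd v → w < v → ¬ (v < y)) → w ≡ x
        same w (w<y , bdw , none) with tri w x
        ... | inj₁ p        = ⊥-elim (none x bdx p x<y)
        ... | inj₂ (inj₁ p) = p
        ... | inj₂ (inj₂ p) = ⊥-elim (least w bdw p w<y)
      y∉ : ¬ dcl M A y
      y∉ p = x∉ (dcl-trans [ dcl-refl , (λ { refl → p }) ]′ x∈)

    module _ (b : ∣ M ∣) (bdb : Bd b) (b∉ : ¬ dcl M A b) where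

      chain : ℕ → ∃[ x ] Bd x × ¬ dcl M A x × dcl M ｛ b ｝ x
      chain zero    = b , bdb , b∉ , dcl-refl refl
      chain (suc n) with chain n
      ... | x , bdx , x∉ , b⊢x with next x bdx x∉
      ...   | y , _ , bdy , y∉ , x⊢y = y , bdy , y∉ , dcl-trans {B = ｛ x ｝} (λ { refl → b⊢x }) x⊢y

      link : ℕ → ∣ M ∣
      link n = proj₁ (chain n)

      link-step : ∀ n → link n < link (suc n)
      link-step n with chain n
      ... | x , bdx , x∉ , b⊢x with next x bdx x∉
      ...   | y , x<y , _ = x<y

      link-mono : ∀ {i j} → i ℕ.<′ j → link i < link j
      link-mono {i} ℕ.<′-base       = link-step i
      link-mono (ℕ.≤′-step {n} i<j) = <-trans (link-mono i<j) (link-step n)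

      code : ∀ n → ∃[ i ] f i b ≡ link n
      code n with chain n
      ... | x , _ , x∉ , b⊢x with dcl-split b⊢x
      ...   | inj₁ (i , _ , refl , p) = i , p
      ...   | inj₂ q                  = ⊥-elim (x∉ (dcl-∅ q))

      impossible : ⊥
      -- There are `suc k` links, each the image of b under one of `k` functions, so two links
      -- coincide although the chain is strictly increasing.
      impossible with Fin.pigeonhole (n<1+n _) (λ (i : Fin (suc k)) → proj₁ (code (Fin.toℕ i)))
      ... | i , j , i<j , same = irrefl (subst (_< _) i≡j (link-mono (<⇒<′ i<j)))
        where
        i≡j : link (Fin.toℕ i) ≡ link (Fin.toℕ j)
        i≡j = trans (sym (proj₂ (code (Fin.toℕ i))))
                (trans (cong (λ l → f l b) same) (proj₂ (code (Fin.toℕ j))))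

  boundary-dcl : ∀ {A : Pred ∣ M ∣ ℓ} (θ : Formula L (suc m)) {ā : Vec ∣ M ∣ m} → VecAll.All A ā →
                 ∀ {b} → ¬ LC lt M θ ā b → dcl M A b
  boundary-dcl {A = A} θ A-ā bdb = dne (λ b∉ → BoundaryChain.impossible A θ A-ā _ bdb b∉)

  generic-LC : ∀ {A : Pred ∣ M ∣ ℓ} (θ : Formula L (suc m)) {ā : Vec ∣ M ∣ m} → VecAll.All A ā →
               ∀ {b} → ¬ dcl M A b → LC lt M θ ā b
  generic-LC θ A-ā b∉ = dne (λ bdb → b∉ (boundary-dcl θ A-ā bdb))

  between : ∀ {u c z} → u < z → c < z → ∃[ x ] u < x × c < x × x < z
  between {u} {c} u<z c<z with maximum u c u<z c<z
  ... | o , o<z , u≤o , c≤o with dense o<z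
  ...   | x , o<x , x<z = x , ≮-trans u≤o o<x , ≮-trans c≤o o<x , x<z

  -- If c ∉ dcl(h), then f j is locally constant at c. Either its value h persists up to +∞, or it
  -- stops at a boundary point z of the set where f j is locally constant, which is in dcl(∅).
  -- Either way h would be definable.
  module Exchange (j : Fin k) {c h : ∣ M ∣} (fc≡h : f j c ≡ h) (h∉ : ¬ dcl M ∅ h)
    (c∉ : ¬ dcl M ｛ h ｝ c) where

    fiber : Formula L 2
    fiber = compile (atom (φ j) (0F ∷ 1F ∷ []))

    fiber-to : ∀ {x} → Sat M fiber (x ∷ h ∷ []) → f j x ≡ h
    fiber-to p = graph j (proj₁ (compile-sat M (atom (φ j) (0F ∷ 1F ∷ [])) (_ ∷ _ ∷ [])) p)

    fiber-from : ∀ {x} → f j x ≡ h → Sat M fiber (x ∷ h ∷ [])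
    fiber-from p = proj₂ (compile-sat M (atom (φ j) (0F ∷ 1F ∷ [])) (_ ∷ _ ∷ [])) (graph⁻¹ j p)

    LC-fiber : ∣ M ∣ → Set ℓ
    LC-fiber = LC lt M fiber (h ∷ [])

    LC-c : LC-fiber c
    LC-c = generic-LC fiber (refl ∷ []) c∉

    constant : ∀ {x} → c < x → (∀ b → c < b → ¬ (x < b) → LC-fiber b) → f j x ≡ h
    constant {x} c<x lc = fiber-to (proj₁ (connected fiber (h ∷ []) c<x lc′) (fiber-from fc≡h))
      where
      lc′ : ∀ b → ¬ (b < c) → ¬ (x < b) → LC-fiber b
      lc′ b c≤b b≤x with tri b c
      ... | inj₁ b<c         = ⊥-elim (c≤b b<c)
      ... | inj₂ (inj₁ refl) = LC-c
      ... | inj₂ (inj₂ c<b)  = lc b c<b b≤x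

    -- Otherwise h would be the value that `f j` takes at all sufficiently large arguments, a
    -- description without parameters.
    no-boundary : ¬ (∀ b → c < b → LC-fiber b)
    no-boundary lc = h∉ (dcl-intro (ex (al (1F ≺ 0F imp atom (φ j) (0F ∷ 2F ∷ [])))) []
      (c , λ x c<x → graph⁻¹ j (constant c<x (λ b c<b _ → lc b c<b))) same)
      where
      -- Past a greatest element "all sufficiently large arguments" would be vacuous and h not
      -- unique.
      unbounded : ∀ b → ∃[ d ] b < d
      unbounded b with tri b c
      ... | inj₁ b<c = c , b<c
      ... | inj₂ (inj₁ refl) = let _ , d , _ , b<d , _ = LC-c in d , b<d
      ... | inj₂ (inj₂ c<b) = let _ , d , _ , b<d , _ = lc b c<b in d , b<d
      same : ∀ h′ → (∃[ e ] (∀ x → e < x → Sat M (φ j) (x ∷ h′ ∷ []))) → h′ ≡ h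
      same h′ (e , p) with tri e c
      ... | inj₁ e<c = trans (sym (graph j (p c e<c))) fc≡h
      ... | inj₂ (inj₁ refl) =
        let x , c<x = unbounded c in trans (sym (graph j (p x c<x))) (constant c<x (λ b c<b _ → lc b c<b))
      ... | inj₂ (inj₂ c<e) =
        let x , e<x = unbounded e
        in trans (sym (graph j (p x e<x))) (constant (<-trans c<e e<x) (λ b c<b _ → lc b c<b))

    module _ {z : ∣ M ∣} (c<z : c < z) (bdz : ¬ LC-fiber z)
      (least : ∀ w → ¬ LC-fiber w → c < w → ¬ (w < z)) where

      constant-below : ∀ {x} → c < x → x < z → f j x ≡ h
      constant-below c<x x<z =
        constant c<x (λ b c<b b≤x → dne (λ bdb → least b bdb c<b (≮-trans b≤x x<z)))

      -- Says that `f j` is constant around the given point, without mentioning h: its boundary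
      -- points therefore lie in dcl(∅), whereas for `fiber` only dcl(h) is obtained. The innermost
      -- variable is the value of `f j`, which is given by its graph and not by a term.
      stationaryC : Cond L 1
      stationaryC = ex (ex (1F ≺ 2F and 2F ≺ 0F and
        al (2F ≺ 0F imp 0F ≺ 1F imp al (atom (φ j) (1F ∷ 0F ∷ []) imp atom (φ j) (4F ∷ 0F ∷ [])))))

      stationary : Formula L 1
      stationary = compile stationaryC

      -- Just below z the function `f j` is constantly h, hence stationary. If stationarity extended
      -- to z itself, `f j` would equal h on a whole neighbourhood of z, and z would not bound the
      -- fiber.
      z-boundary : ¬ LC lt M stationary [] z
      z-boundary (u , v , u<z , z<v , near) with between u<z c<z
      ... | x , u<x , c<x , x<z
        with proj₁ (compile-sat M stationaryC (z ∷ []))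
               (proj₁ (near x u<x (<-trans x<z z<v))
                 (proj₂ (compile-sat M stationaryC (x ∷ []))
                   (c , z , c<x , x<z , λ y c<y y<z w p →
                     graph⁻¹ j (trans (constant-below c<x x<z)
                       (trans (sym (constant-below c<y y<z)) (graph j p))))))
      ... | u′ , v′ , u′<z , z<v′ , p with between u′<z c<z
      ...   | y , u′<y , c<y , y<z =
        bdz (u′ , v′ , u′<z , z<v′ , λ w u′<w w<v′ →
          (λ _ → fiber-from fz≡h) , (λ _ → fiber-from (trans (value u′<w w<v′) fz≡h)))
        where
        value : ∀ {w} → u′ < w → w < v′ → f j w ≡ f j z
        value {w} u′<w w<v′ = sym (graph j (p w u′<w w<v′ _ (graph⁻¹ j refl)))
        fz≡h : f j z ≡ h
        fz≡h = trans (sym (value u′<y (<-trans y<z z<v′))) (constant-below c<y y<z)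

      -- h is the value of `f j` immediately to the left of z.
      h∈dclz : dcl M ｛ z ｝ h
      h∈dclz = dcl-intro
        (ex (0F ≺ 2F and al (1F ≺ 0F imp 0F ≺ 3F imp atom (φ j) (0F ∷ 2F ∷ [])))) (refl ∷ [])
        (c , c<z , λ x c<x x<z → graph⁻¹ j (constant-below c<x x<z)) same
        where
        same : ∀ h′ → (∃[ e ] e < z × (∀ x → e < x → x < z → Sat M (φ j) (x ∷ h′ ∷ []))) → h′ ≡ h
        same h′ (e , e<z , p) with between e<z c<z
        ... | x , e<x , c<x , x<z = trans (sym (graph j (p x e<x x<z))) (constant-below c<x x<z)

      z∈dcl∅ : dcl M ∅ z
      z∈dcl∅ with dcl-split (boundary-dcl {A = λ _ → Poly.⊥} stationary [] z-boundary)
      ... | inj₁ (_ , _ , () , _)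
      ... | inj₂ p = p

      impossible : ⊥
      impossible = h∉ (dcl-trans-∅ z∈dcl∅ h∈dclz)

  exchange : ∀ j {c h} → f j c ≡ h → ¬ dcl M ∅ h → dcl M ｛ h ｝ c
  exchange j {c} {h} fc≡h h∉ = dne λ c∉ →
    let open Exchange j fc≡h h∉ c∉
        b , ¬p = ¬∀⇒∃¬ no-boundary
        c<b , bdb = ¬→⇒×¬ ¬p
        z , c<z , bdz , least = next-boundary fiber (h ∷ []) bdb c<b
    in impossible c<z bdz least

-- Small sets

module Smallness (em : ∀ {a} → ExcludedMiddle a) (κ : Cardinal ℓ)
  (inaccessible : IsStronglyInaccessible κ) where

  open Classical em
  open Cardinal κ
  open IsStronglyInaccessible inaccessible
  open IsStrictTotalOrder isStrictTotalOrder using (compare) renaming (trans to <-trans; irrefl to <-irrefl)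

  Small : {X : Set ℓ} → Pred X ℓ → Set ℓ
  Small P = CardLess P κ

  ordinal : Carrier
  ordinal = proj₁ (proj₂ uncountable) 0

  successor : ∀ α → ∃[ β ] α < β
  -- Regularity is applied to a constant function; the segment taken contains `ordinal`, so the
  -- bound really exceeds α.
  successor α with regular (proj₁ uncountable) (λ _ → α)
  ... | β , bound = β , bound ordinal (proj₁ (proj₂ (proj₂ uncountable)) _)

  upperBound : ∀ α β → ∃[ γ ] α < γ × β < γ
  upperBound α β with compare α β | successor α | successor β
  ... | tri< α<β _ _  | _       | γ , β<γ = γ , <-trans α<β β<γ , β<γ
  ... | tri≈ _ refl _ | _       | γ , β<γ = γ , β<γ , β<γ
  ... | tri> _ _ β<α  | γ , α<γ | _       = γ , α<γ , <-trans β<α α<γ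

  least : ∀ {p} (Q : Carrier → Set p) {α} → Q α → ∃[ β ] Q β × (∀ γ → Q γ → ¬ (γ < β))
  least Q {α} Qα = go α (wellFounded α) Qα
    where
    go : ∀ α → Acc _<_ α → Q α → ∃[ β ] Q β × (∀ γ → Q γ → ¬ (γ < β))
    go α (acc rs) Qα with em {P = ∃[ γ ] Q γ × γ < α}
    ... | yes (γ , Qγ , γ<α) = go γ (rs γ<α) Qγ
    ... | no none            = α , Qα , λ γ Qγ γ<α → none (γ , Qγ , γ<α)

  module _ {X : Set ℓ} where

    small-⊆ : {P Q : Pred X ℓ} → (∀ {x} → P x → Q x) → Small Q → Small P
    small-⊆ P⊆Q (α , g , below , inj) =
      α , g , (λ p → below (P⊆Q p)) , (λ p q → inj (P⊆Q p) (P⊆Q q))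

    small-subsingleton : {P : Pred X ℓ} → (∀ {x y} → P x → P y → x ≡ y) → Small P
    small-subsingleton unique =
      proj₁ uncountable , (λ _ → ordinal) , (λ _ → proj₁ (proj₂ (proj₂ uncountable)) _) , λ p q _ → unique p q

    -- An element of P is coded by the subset {g x} of α and an element of Q outside P
    -- by {g′ x , α}; the strong limit property bounds the number of these codes.
    small-∪ : {P Q : Pred X ℓ} → Small P → Small Q → Small (P ∪ Q)
    small-∪ {P} {Q} (α₁ , g , g<α₁ , g-inj) (α₂ , g′ , g′<α₂ , g′-inj)
      with upperBound α₁ α₂
    ... | α , α₁<α , α₂<α with successor α
    ...   | α⁺ , α<α⁺ with strongLimit α⁺
    ...     | β , code , code<β , code-inj = β , (λ x → code (chosen x)) , (λ _ → code<β _) , inj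
      where
      Codes : X → Carrier → Set ℓ
      Codes x γ = (P x × γ ≡ g x) ⊎ (¬ P x × (γ ≡ g′ x ⊎ γ ≡ α))
      chosen : X → Carrier → Bool
      chosen x γ = does (em {P = Codes x γ})
      agree : ∀ {x y} → code (chosen x) ≡ code (chosen y) → ∀ {γ} → γ < α⁺ → Codes x γ → Codes y γ
      agree {x} {y} eq {γ} γ<α⁺ c with em {P = Codes x γ} | em {P = Codes y γ}
                                     | Equivalence.to (code-inj _ _) eq γ γ<α⁺
      ... | yes _ | yes c′ | _ = c′
      ... | no ¬c | _      | _ = ⊥-elim (¬c c)
      ... | yes _ | no _   | ()
      inj : ∀ {x y} → P x ⊎ Q x → P y ⊎ Q y → code (chosen x) ≡ code (chosen y) → x ≡ y
      inj {x} {y} p q eq with em {P = P x} | em {P = P y}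
      ... | yes Px | yes Py with agree eq (<-trans (g<α₁ Px) (<-trans α₁<α α<α⁺)) (inj₁ (Px , refl))
      ...   | inj₁ (_ , gx≡gy) = g-inj Px Py gx≡gy
      ...   | inj₂ (¬Py , _)   = ⊥-elim (¬Py Py)
      inj {x} {y} p q eq | yes Px | no ¬Py with agree (sym eq) α<α⁺ (inj₂ (¬Py , inj₂ refl))
      ...   | inj₁ (_ , α≡gx) = ⊥-elim (<-irrefl (sym α≡gx) (<-trans (g<α₁ Px) α₁<α))
      ...   | inj₂ (¬Px , _)  = ⊥-elim (¬Px Px)
      inj {x} {y} p q eq | no ¬Px | yes Py with agree eq α<α⁺ (inj₂ (¬Px , inj₂ refl))
      ...   | inj₁ (_ , α≡gy) = ⊥-elim (<-irrefl (sym α≡gy) (<-trans (g<α₁ Py) α₁<α))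
      ...   | inj₂ (¬Py , _)  = ⊥-elim (¬Py Py)
      inj {x} {y} (inj₁ Px) q eq | no ¬Px | no _ = ⊥-elim (¬Px Px)
      inj {x} {y} p (inj₁ Py) eq | no _ | no ¬Py = ⊥-elim (¬Py Py)
      inj {x} {y} (inj₂ Qx) (inj₂ Qy) eq | no ¬Px | no ¬Py
        with agree eq (<-trans (g′<α₂ Qx) (<-trans α₂<α α<α⁺)) (inj₂ (¬Px , inj₁ refl))
      ...   | inj₁ (Py , _)              = ⊥-elim (¬Py Py)
      ...   | inj₂ (_ , inj₁ g′x≡g′y)    = g′-inj Qx Qy g′x≡g′y
      ...   | inj₂ (_ , inj₂ g′x≡α)      = ⊥-elim (<-irrefl g′x≡α (<-trans (g′<α₂ Qx) α₂<α))

    -- Each member is coded by an index below α that R relates to it, and an index serves at most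
    -- one member. The default α is used outside the set only.
    small-image : ∀ α (R : Carrier → X → Set ℓ) → (∀ {β x y} → R β x → R β y → x ≡ y) →
                  Small (λ x → ∃[ β ] β < α × R β x)
    small-image α R unique =
      α , (λ x → proj₁ (select x)) , (λ {x} p → proj₁ (proj₂ (select x) p)) ,
      λ {x} {y} p q eq → unique (subst (λ β → R β x) eq (proj₂ (proj₂ (select x) p)))
                                (proj₂ (proj₂ (select y) q))
      where
      select : ∀ x → ∃[ β ] ((∃[ γ ] γ < α × R γ x) → β < α × R β x)
      select x with em {P = ∃[ γ ] γ < α × R γ x}
      ... | yes (γ , p) = γ , λ _ → p
      ... | no ¬p       = α , λ p → ⊥-elim (¬p p)

-- Partial elementary maps respecting two generic predicates

module PartialMaps (em : ∀ {a} → ExcludedMiddle a) (κ : Cardinal ℓ)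
  (inaccessible : IsStronglyInaccessible κ) {L : Language ℓ} (lt : Language.Relation L 2)
  (M : Structure L) (tame : Tame lt M) (saturated : IsSaturated M κ)
  (f : Fin k → ∣ M ∣ → ∣ M ∣) (f-def : ∀ i → IsZeroDefinable M (f i))
  (trivial : ∀ (A : Pred ∣ M ∣ ℓ) →
    dcl M A ≐ ((λ b → ∃[ i ] ∃[ a ] A a × f i a ≡ b) ∪ dcl M ∅)) where

  open Classical em
  open Tame tame
  open DenseOrder denseOrder
  open RightGerm em lt M tame
  open Trivial em lt M tame f f-def trivial
  open Smallness em κ inaccessible

  private
    _<_ = order lt M

  realizing-interval : ∀ {B q} → Small B → IsType M B q →
                       (∀ x → Realizes M x q → ¬ dcl M B x) →
                       ∃[ c ] ∃[ d ] c < d × (∀ x → c < x → x < d → Realizes M x q)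
  realizing-interval {B} {q} small type non-dcl with saturated B small q type
  -- The formula is arbitrary: local constancy at c is used here only to obtain a point e above c.
  ... | c , real-c with generic-LC (compile (0F == 0F)) [] (non-dcl c real-c)
  ...   | _ , e , _ , c<e , _
    with saturated (B ∪ ｛ c ｝) (small-∪ small (small-subsingleton (λ { refl refl → refl })))
           (RightType _ c) (rightType-isType _ c c<e)
  ...     | d , real-d =
    c , d , rightType-> _ c (inj₂ refl) c<e (λ {ψ} → real-d {ψ}) , λ x c<x x<d {ψ} → real-x c<x x<d ψ
    where
    real-x : ∀ {x} → c < x → x < d → ∀ ψ → q ψ → Solutions M ψ x
    real-x {x} c<x x<d (m , ψ , ā) qψ with generic-LC ψ (IsType.over type qψ) (non-dcl c real-c)
    ... | u , v , u<c , c<v , near = proj₁ (compile-sat M throughout (d ∷ c ∷ ā)) below x c<x x<d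
      where
      -- Says of a point y that ψ holds on all of (c , y). It is true for y immediately to the right
      -- of c, hence of d; thus d lies below the neighbourhoods for all ψ ∈ q at once.
      throughout : Cond L (suc (suc m))
      throughout = al (_<′_ lt 2F 0F imp _<′_ lt 0F 1F imp param 3 ψ 0F)
      below : Sat M (compile throughout) (d ∷ c ∷ ā)
      below = real-d {suc m , compile throughout , c ∷ ā}
        ((inj₂ refl ∷ VecAll.map inj₁ (IsType.over type qψ)) ,
         v , c<v , λ y _ y<v → proj₂ (compile-sat M throughout (y ∷ c ∷ ā))
           (λ z c<z z<y → proj₂ (near z (<-trans u<c c<z) (<-trans z<y y<v)) (real-c qψ)))

  -- A relation, so that inverses and unions of chains are immediate. Functionality and injectivity
  -- come from `elementary` applied to an equation between two variables.
  PartialMap : Set (Level.suc ℓ)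
  PartialMap = ∣ M ∣ → ∣ M ∣ → Set ℓ

  Dom Ran : PartialMap → Pred ∣ M ∣ ℓ
  Dom G x = ∃[ y ] G x y
  Ran G y = ∃[ x ] G x y

  -- If some h ∈ D were definable over `Dom G` without belonging to it, its image would be forced,
  -- with no control over whether it lies in E. The two closure conditions exclude this situation on
  -- both sides.
  record Good (D E : Pred ∣ M ∣ ℓ) (G : PartialMap) : Set ℓ where
    field
      elementary : (θ : Formula L n) → ∀ {xs ys} → Pointwise G xs ys → Sat M θ xs ⟺ Sat M θ ys
      marked     : ∀ {x y} → G x y → D x ⟺ E y
      dom-closed : ∀ {h} → D h → dcl M (Dom G) h → Dom G h
      ran-closed : ∀ {h} → E h → dcl M (Ran G) h → Ran G h

    elementaryC : (C : Cond L n) → ∀ {xs ys} → Pointwise G xs ys → ⟦ C ⟧ M xs ⟺ ⟦ C ⟧ M ys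
    elementaryC C {xs} {ys} g =
      (λ p → proj₁ (compile-sat M C ys) (proj₁ (elementary (compile C) g) (proj₂ (compile-sat M C xs) p))) ,
      (λ p → proj₁ (compile-sat M C xs) (proj₂ (elementary (compile C) g) (proj₂ (compile-sat M C ys) p)))

  flip-good : ∀ {D E G} → Good D E G → Good E D (flip G)
  flip-good good = record
    { elementary = λ θ g → swap (elementary θ (Pointwise.sym id g))
    ; marked     = λ g → swap (marked g)
    ; dom-closed = ran-closed
    ; ran-closed = dom-closed
    }
    where open Good good

  good-resp : ∀ {D E G G′} → (∀ x y → G x y ⟺ G′ x y) → Good D E G → Good D E G′
  good-resp eq good = record
    { elementary = λ θ g → elementary θ (Pointwise.map (λ {x} {y} → proj₂ (eq x y)) g)
    ; marked     = λ {x} {y} g → marked (proj₂ (eq x y) g)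
    ; dom-closed = λ {h} Dh p →
        let y , g = dom-closed Dh (dcl-mono (λ {x} (y , g) → y , proj₂ (eq x y) g) p)
        in y , proj₁ (eq h y) g
    ; ran-closed = λ {h} Eh p →
        let x , g = ran-closed Eh (dcl-mono (λ {y} (x , g) → x , proj₂ (eq x y) g) p)
        in x , proj₁ (eq x h) g
    }
    where open Good good

  Extend : PartialMap → ∣ M ∣ → ∣ M ∣ → PartialMap
  Extend G c c′ x y = G x y ⊎ (x ≡ c × y ≡ c′)

  -- x realizes the image under G of the type of c over the domain of G.
  Corresponds : PartialMap → ∣ M ∣ → ∣ M ∣ → Set ℓ
  Corresponds G c x = ∀ {m} (θ : Formula L (suc m)) {ā b̄} → Pointwise G ā b̄ →
                      Sat M θ (c ∷ ā) → Sat M θ (x ∷ b̄)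

  corresponds⁻¹ : ∀ {G c x} → Corresponds G c x → ∀ {m} (θ : Formula L (suc m)) {ā b̄} →
                  Pointwise G ā b̄ → Sat M θ (x ∷ b̄) → Sat M θ (c ∷ ā)
  corresponds⁻¹ corr θ g p = dne (λ ¬q →
    neg-elim M {φ = θ} (corr (neg θ) g (neg-intro M {φ = θ} ¬q)) p)

  -- All variables that take the new pair are merged into variable zero, and the others become
  -- parameters related by G; r is the corresponding renaming.
  split-vars : ∀ {G c c′} {xs ys : Vec ∣ M ∣ n} → Pointwise (Extend G c c′) xs ys →
               ∃[ m ] Σ[ ā ∈ Vec ∣ M ∣ m ] Σ[ b̄ ∈ Vec ∣ M ∣ m ] Σ[ r ∈ (Fin n → Fin (suc m)) ]
                 Pointwise G ā b̄ ×
                 (∀ i → lookup (c ∷ ā) (r i) ≡ lookup xs i) ×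
                 (∀ i → lookup (c′ ∷ b̄) (r i) ≡ lookup ys i)
  split-vars [] = 0 , [] , [] , (λ ()) , [] , (λ ()) , (λ ())
  split-vars {G = G} {c} {c′} {x ∷ xs} {y ∷ ys} (g ∷ gs) with split-vars gs
  split-vars {G = G} {c} {c′} {x ∷ xs} {y ∷ ys} (inj₂ (refl , refl) ∷ gs) | m , ā , b̄ , r , G-ā , eq , eq′ =
    m , ā , b̄ , r⁺ , G-ā , (λ { zero → refl ; (suc i) → eq i }) , (λ { zero → refl ; (suc i) → eq′ i })
    where
    r⁺ : Fin _ → Fin _
    r⁺ zero    = zero
    r⁺ (suc i) = r i
  split-vars {G = G} {c} {c′} {x ∷ xs} {y ∷ ys} (inj₁ g ∷ gs) | m , ā , b̄ , r , G-ā , eq , eq′ =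
    suc m , x ∷ ā , y ∷ b̄ , r⁺ , g ∷ G-ā ,
    (λ { zero → refl ; (suc i) → trans (shift c x ā (r i)) (eq i) }) ,
    (λ { zero → refl ; (suc i) → trans (shift c′ y b̄ (r i)) (eq′ i) })
    where
    r⁺ : Fin _ → Fin _
    r⁺ zero    = suc zero
    r⁺ (suc i) = Fin.lift 1 suc (r i)
    shift : ∀ c a (ā : Vec ∣ M ∣ m) i → lookup (c ∷ a ∷ ā) (Fin.lift 1 suc i) ≡ lookup (c ∷ ā) i
    shift c a ā zero    = refl
    shift c a ā (suc i) = refl

  extend-elementary : ∀ {G c c′} → Corresponds G c c′ → (θ : Formula L n) → ∀ {xs ys} →
                      Pointwise (Extend G c c′) xs ys → Sat M θ xs ⟺ Sat M θ ys
  extend-elementary {c = c} {c′} corr θ g with split-vars g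
  ... | m , ā , b̄ , r , G-ā , eq , eq′ =
    (λ p → proj₁ (sat-ren M r eq′ θ) (corr (ren r θ) G-ā (proj₂ (sat-ren M r eq θ) p))) ,
    (λ p → proj₁ (sat-ren M r eq θ) (corresponds⁻¹ corr (ren r θ) G-ā (proj₂ (sat-ren M r eq′ θ) p)))

  module Transport {D E : Pred ∣ M ∣ ℓ} {G : PartialMap} (good : Good D E G) (c : ∣ M ∣) where

    open Good good

    ImageType : Pred (ParamFormula M) ℓ
    ImageType (m , θ , b̄) = Σ[ ā ∈ Vec ∣ M ∣ m ] Pointwise G ā b̄ × Sat M θ (c ∷ ā)

    private
      inˡ : ∀ {m₁} m₂ → Fin (suc m₁) → Fin (suc (m₁ + m₂))
      inˡ m₂ = Fin.lift 1 (_↑ˡ m₂)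

      inʳ : ∀ m₁ {m₂} → Fin (suc m₂) → Fin (suc (m₁ + m₂))
      inʳ m₁ = Fin.lift 1 (m₁ ↑ʳ_)

      lookup-inˡ : ∀ {m₁ m₂} x (ā : Vec ∣ M ∣ m₁) (b̄ : Vec ∣ M ∣ m₂) i →
                   lookup (x ∷ (ā Vec.++ b̄)) (inˡ m₂ i) ≡ lookup (x ∷ ā) i
      lookup-inˡ x ā b̄ zero    = refl
      lookup-inˡ x ā b̄ (suc i) = lookup-++ˡ ā b̄ i

      lookup-inʳ : ∀ {m₁ m₂} x (ā : Vec ∣ M ∣ m₁) (b̄ : Vec ∣ M ∣ m₂) i →
                   lookup (x ∷ (ā Vec.++ b̄)) (inʳ m₁ i) ≡ lookup (x ∷ b̄) i
      lookup-inʳ x ā b̄ zero    = refl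
      lookup-inʳ x ā b̄ (suc i) = lookup-++ʳ ā b̄ i

    -- Elementarity transports one existential formula at a time, so finitely many formulas, each
    -- with its own parameters, are merged into one over the concatenated parameters.
    combine : ∀ {θs} → All ImageType θs →
              ∃[ ψ ] ImageType ψ × (∀ x → Solutions M ψ x → All (λ θ → Solutions M θ x) θs)
    combine [] = (0 , falsum ⇒ falsum , []) , ([] , [] , id) , λ _ _ → []
    combine (_∷_ {x = m₁ , θ , b̄₁} (ā₁ , g₁ , p₁) qs) with combine qs
    ... | (m₂ , ψ , b̄₂) , (ā₂ , g₂ , p₂) , entails =
      (m₁ + m₂ , conj θ′ ψ′ , b̄₁ Vec.++ b̄₂) ,
      (ā₁ Vec.++ ā₂ , Pointwise.++⁺ g₁ g₂ , proj₂ (conj-sat M θ′ ψ′ _)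
        (proj₂ (sat-ren M (inˡ m₂) (lookup-inˡ c ā₁ ā₂) θ) p₁ ,
         proj₂ (sat-ren M (inʳ m₁) (lookup-inʳ c ā₁ ā₂) ψ) p₂)) ,
      λ x p → let pθ , pψ = proj₁ (conj-sat M θ′ ψ′ _) p in
        proj₁ (sat-ren M (inˡ m₂) (lookup-inˡ x b̄₁ b̄₂) θ) pθ ∷
        entails x (proj₁ (sat-ren M (inʳ m₁) (lookup-inʳ x b̄₁ b̄₂) ψ) pψ)
      where
      θ′ = ren (inˡ m₂) θ
      ψ′ = ren (inʳ m₁) ψ

    preimages : ∀ {m} {b̄ : Vec ∣ M ∣ m} → VecAll.All (Ran G) b̄ → Σ[ ā ∈ Vec ∣ M ∣ m ] Pointwise G ā b̄
    preimages []             = [] , []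
    preimages ((a , g) ∷ gs) = let ā , G-ā = preimages gs in a ∷ ā , g ∷ G-ā

    images : ∀ {m} {ā : Vec ∣ M ∣ m} → VecAll.All (Dom G) ā → Σ[ b̄ ∈ Vec ∣ M ∣ m ] Pointwise G ā b̄
    images []             = [] , []
    images ((b , g) ∷ gs) = let b̄ , G-ā = images gs in b ∷ b̄ , g ∷ G-ā

    in-range : ∀ {m} {ā b̄ : Vec ∣ M ∣ m} → Pointwise G ā b̄ → VecAll.All (Ran G) b̄
    in-range []       = []
    in-range (g ∷ gs) = (_ , g) ∷ in-range gs

    in-domain : ∀ {m} {ā b̄ : Vec ∣ M ∣ m} → Pointwise G ā b̄ → VecAll.All (Dom G) ā
    in-domain []       = []
    in-domain (g ∷ gs) = (_ , g) ∷ in-domain gs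

    satisfy : ∀ {θs} → All ImageType θs → ∃[ x ] All (λ θ → Solutions M θ x) θs
    satisfy qs with combine qs
    ... | (m , ψ , b̄) , (ā , g , p) , entails
      with proj₁ (elementaryC (ex (param 1 ψ 0F)) g) (c , p)
    ...   | x , q = x , entails x q

    imageType-isType : IsType M (Ran G) ImageType
    imageType-isType = record
      { over        = λ (_ , g , _) → in-range g
      ; satisfiable = satisfy
      ; complete    = λ (m , θ , b̄) over → decide θ over (preimages over)
      }
      where
      decide : ∀ {m} (θ : Formula L (suc m)) {b̄} → VecAll.All (Ran G) b̄ →
               Σ[ ā ∈ Vec ∣ M ∣ m ] Pointwise G ā b̄ →
               ImageType (m , θ , b̄) ⊎ ImageType (m , neg θ , b̄)
      decide θ _ (ā , g) with em {P = Sat M θ (c ∷ ā)}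
      ... | yes p = inj₁ (ā , g , p)
      ... | no ¬p = inj₂ (ā , g , neg-intro M {φ = θ} ¬p)

    realizes⇒corresponds : ∀ {x} → Realizes M x ImageType → Corresponds G c x
    realizes⇒corresponds real θ {ā} {b̄} g p = real {_ , θ , b̄} (ā , g , p)

    private
      uniqueC : Formula L (suc m) → Cond L m
      uniqueC θ = al (al (param 2 θ 1F imp param 2 θ 0F imp 1F == 0F))

    -- Having at most one solution is a property of the parameters b̄ and goes back to ā; then θ
    -- would isolate c over `Dom G`.
    corresponds-∉dcl : ∀ {x} → Corresponds G c x → ¬ dcl M (Dom G) c → ¬ dcl M (Ran G) x
    corresponds-∉dcl {x} corr c∉ ((m , θ , b̄) , over , unique , here′) with preimages over
    ... | ā , g with proj₂ (elementaryC (uniqueC θ) g) (λ _ _ p q → trans (sym (unique p)) (unique q))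
    ...   | unique′ = c∉ ((m , θ , ā) , in-domain g , (λ p → unique′ c _ θc p) , λ { refl → θc })
      where
      θc : Sat M θ (c ∷ ā)
      θc = corresponds⁻¹ corr θ g (here′ refl)

    -- The formula θ defining c isolates the image type: its unique solution x over b̄ also
    -- satisfies every other ψ of the type, since θ and ψ have a common solution.
    algebraic-partner : dcl M (Dom G) c → ∃[ x ] Corresponds G c x × dcl M (Ran G) x
    algebraic-partner ((m , θ , ā) , over , unique , here′) with images over
    ... | b̄ , g with proj₁ (elementaryC (uniqueC θ) g) (λ _ _ p q → trans (sym (unique p)) (unique q))
                   | satisfy {(m , θ , b̄) ∷ []} ((ā , g , here′ refl) ∷ [])
    ...   | unique′ | x , θx ∷ [] =
      x , corr , ((m , θ , b̄) , in-range g , (λ p → unique′ x _ θx p) , λ { refl → θx })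
      where
      corr : Corresponds G c x
      corr ψ {ā₂} {b̄₂} g₂ p with satisfy {(m , θ , b̄) ∷ (_ , ψ , b̄₂) ∷ []} ((ā , g , here′ refl) ∷ (ā₂ , g₂ , p) ∷ [])
      ... | y , θy ∷ ψy ∷ [] = subst (λ z → Sat M ψ (z ∷ b̄₂)) (unique′ y x θy θx) ψy

    corresponds-old : ∀ {x y} → Corresponds G c x → G c y → x ≡ y
    corresponds-old corr g = corr (var zero ≈ var (suc zero)) (g ∷ []) refl

    corresponds-old⁻¹ : ∀ {x z} → Corresponds G c x → G z x → c ≡ z
    corresponds-old⁻¹ corr g = corresponds⁻¹ corr (var zero ≈ var (suc zero)) (g ∷ []) refl

  -- If c ∈ D, then `dom-closed` has c in `Dom G` already, and likewise for x ∈ E; so the marking of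
  -- the new pair is that of an old one. The definable closures of domain and range do not grow.
  extend-good-dcl : ∀ {D E G c} → Good D E G → dcl M (Dom G) c → ∃[ x ] Good D E (Extend G c x)
  extend-good-dcl {D} {E} {G} {c} good c∈ with Transport.algebraic-partner good c c∈
  ... | x , corr , x∈ = x , record
    { elementary = extend-elementary corr
    ; marked     = λ { (inj₁ g) → marked g ; (inj₂ (refl , refl)) → to , from }
    ; dom-closed = λ Dh p →
        let y , g = dom-closed Dh (dcl-trans (λ { (_ , inj₁ g) → dcl-refl (_ , g)
                                                ; (_ , inj₂ (refl , _)) → c∈ }) p)
        in y , inj₁ g
    ; ran-closed = λ Eh p →
        let y , g = ran-closed Eh (dcl-trans (λ { (_ , inj₁ g) → dcl-refl (_ , g)
                                                ; (_ , inj₂ (_ , refl)) → x∈ }) p)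
        in y , inj₁ g
    }
    where
    open Good good
    open Transport good c
    to : D c → E x
    to Dc with dom-closed Dc c∈
    ... | y , g = subst E (sym (corresponds-old corr g)) (proj₁ (marked g) Dc)
    from : E x → D c
    from Ex with ran-closed Ex x∈
    ... | z , g = subst D (sym (corresponds-old⁻¹ corr g)) (proj₂ (marked g) Ex)

  -- Adding c to the domain brings no new element of D into its definable closure, except c itself.
  Inert : Pred ∣ M ∣ ℓ → ∣ M ∣ → Set ℓ
  Inert D c = ∀ {h} → D h → ∀ i → f i c ≡ h → c ≡ h

  inert-dcl : ∀ {D A c h} → IsGeneric lt M f D → Inert D c → D h → dcl M (A ∪ ｛ c ｝) h → dcl M A h ⊎ c ≡ h
  inert-dcl D-generic inert Dh p with dcl-∪ p
  ... | inj₁ q = inj₁ q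
  ... | inj₂ q with dcl-split q
  ...   | inj₁ (i , _ , refl , eq) = inj₂ (inert Dh i eq)
  ...   | inj₂ r = ⊥-elim (IsGeneric.transcendental D-generic Dh r)

  extend-good-inert : ∀ {D E G c x} → IsGeneric lt M f D → IsGeneric lt M f E → Good D E G →
                      Corresponds G c x → D c ⟺ E x → Inert D c → Inert E x →
                      Good D E (Extend G c x)
  extend-good-inert D-generic E-generic good corr mark inert-c inert-x = record
    { elementary = extend-elementary corr
    ; marked     = λ { (inj₁ g) → marked g ; (inj₂ (refl , refl)) → mark }
    ; dom-closed = λ Dh p →
        [ (λ q → let y , g = dom-closed Dh q in y , inj₁ g) , (λ { refl → _ , inj₂ (refl , refl) }) ]′
          (inert-dcl D-generic inert-c Dh
            (dcl-mono (λ { (y , inj₁ g) → inj₁ (y , g) ; (_ , inj₂ (refl , _)) → inj₂ refl }) p))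
    ; ran-closed = λ Eh p →
        [ (λ q → let y , g = ran-closed Eh q in y , inj₁ g) , (λ { refl → _ , inj₂ (refl , refl) }) ]′
          (inert-dcl E-generic inert-x Eh
            (dcl-mono (λ { (y , inj₁ g) → inj₁ (y , g) ; (_ , inj₂ (_ , refl)) → inj₂ refl }) p))
    }
    where open Good good

  marked-inert : ∀ {D c} → IsGeneric lt M f D → D c → Inert D c
  marked-inert D-generic Dc Dh i eq = IsGeneric.independent D-generic Dh Dc i eq

  -- This is where exchange enters: if h = f i(c) were in D, then c would lie in dcl(h), hence in
  -- dcl(D).
  generic-inert : ∀ {D c} → IsGeneric lt M f D → ¬ dcl M D c → Inert D c
  generic-inert D-generic c∉ Dh i eq = ⊥-elim
    (c∉ (dcl-trans (λ { refl → dcl-refl Dh }) (exchange i eq (IsGeneric.transcendental D-generic Dh))))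

  -- The second alternative excludes that c ∈ dcl(D) is added before the element of D it depends on.
  Ready : Pred ∣ M ∣ ℓ → PartialMap → ∣ M ∣ → Set ℓ
  Ready D G c = D c ⊎ ((∃[ h ] D h × ∃[ i ] f i h ≡ c) → ∃[ h ] Dom G h × ∃[ i ] f i h ≡ c)

  module _ {D E : Pred ∣ M ∣ ℓ} {G : PartialMap} {c : ∣ M ∣} (D-generic : IsGeneric lt M f D)
    (E-generic : IsGeneric lt M f E) (good : Good D E G) (c∉ : ¬ dcl M (Dom G) c)
    {u v : ∣ M ∣} (u<v : u < v) (corr : ∀ x → u < x → x < v → Corresponds G c x) where

    extend-marked : D c → ∃[ x ] Good D E (Extend G c x)
    extend-marked Dc with IsGeneric.dense E-generic u<v
    ... | x , Ex , u<x , x<v =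
      x , extend-good-inert D-generic E-generic good (corr x u<x x<v) ((λ _ → Ex) , (λ _ → Dc))
            (marked-inert D-generic Dc) (marked-inert E-generic Ex)

    -- `codense` keeps x out of the images of E, and c ∉ dcl(Dom G) keeps it out of dcl(∅); by
    -- triviality x ∉ dcl(E).
    extend-independent : ¬ dcl M D c → ∃[ x ] Good D E (Extend G c x)
    extend-independent c∉D with IsGeneric.codense E-generic u<v
    ... | x , u<x , x<v , x≢ =
      x , extend-good-inert D-generic E-generic good (corr x u<x x<v)
            ((λ Dc → ⊥-elim (c∉D (dcl-refl Dc))) , (λ Ex → ⊥-elim (x∉E (dcl-refl Ex))))
            (generic-inert D-generic c∉D) (generic-inert E-generic x∉E)
      where
      x∉E : ¬ dcl M E x
      x∉E p = [ (λ (i , y , Ey , eq) → x≢ y Ey i eq) ,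
                (λ q → Transport.corresponds-∉dcl good c (corr x u<x x<v) c∉ (dcl-∅ q)) ]′ (dcl-split p)

  -- The mixed case, c in dcl(D) but not in D, would put c into dcl(Dom G), because an element of D
  -- producing c is already in the domain.
  ready-∉dcl : ∀ {D G c} → Ready D G c → ¬ dcl M (Dom G) c → D c ⊎ ¬ dcl M D c
  ready-∉dcl (inj₁ Dc)  _  = inj₁ Dc
  ready-∉dcl {D} {G} {c} (inj₂ dep) c∉ = inj₂ λ p →
    [ (λ (i , h , Dh , eq) → dependent (dep (h , Dh , i , eq))) , (λ q → c∉ (dcl-∅ q)) ]′ (dcl-split p)
    where
    dependent : ¬ (∃[ h ] Dom G h × ∃[ i ] f i h ≡ c)
    dependent (h , h∈ , i , refl) = c∉ (dcl-image i h∈)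

  image-interval : ∀ {D E G c} → Good D E G → Small (Ran G) → ¬ dcl M (Dom G) c →
                   ∃[ u ] ∃[ v ] u < v × (∀ x → u < x → x < v → Corresponds G c x)
  image-interval {c = c} good small c∉ =
    let u , v , u<v , real = realizing-interval small imageType-isType
          (λ x real → corresponds-∉dcl (realizes⇒corresponds (λ {ψ} → real {ψ})) c∉)
    in u , v , u<v , λ x u<x x<v → realizes⇒corresponds (λ {ψ} → real x u<x x<v {ψ})
    where open Transport good c

  forth : ∀ {D E G c} → IsGeneric lt M f D → IsGeneric lt M f E → Good D E G → Small (Ran G) →
          Ready D G c → ∃[ x ] Good D E (Extend G c x)
  forth {D} {E} {G} {c} D-generic E-generic good small ready = by-cases em
    where
    by-cases : Dec (dcl M (Dom G) c) → ∃[ x ] Good D E (Extend G c x)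
    by-cases (yes c∈) = extend-good-dcl good c∈
    by-cases (no c∉)  =
      let u , v , u<v , corr = image-interval good small c∉
      in [ extend-marked D-generic E-generic good c∉ u<v corr
         , extend-independent D-generic E-generic good c∉ u<v corr ]′ (ready-∉dcl ready c∉)

-- Transfinite back-and-forth

module Iteration (κ : Cardinal ℓ) {X Y : Set ℓ}
  (step : Cardinal.Carrier κ → (X → Y → Set ℓ) → (X → Y → Set ℓ))
  (step-resp : ∀ α {G G′} → (∀ x y → G x y ⟺ G′ x y) → ∀ x y → step α G x y ⟺ step α G′ x y)
  (inflationary : ∀ α {G x y} → G x y → step α G x y) where

  open Cardinal κ

  stage : ∀ α → Acc _<_ α → X → Y → Set ℓ
  stage α (acc rs) = step α (λ x y → ∃[ β ] Σ[ β<α ∈ β < α ] stage β (rs β<α) x y)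

  -- Stages built from different accessibility proofs agree only up to pointwise equivalence, which
  -- `step` has to respect; `step` need not be monotone.
  stage-irrelevant : ∀ α (p q : Acc _<_ α) x y → stage α p x y ⟺ stage α q x y
  stage-irrelevant α (acc rs) (acc rs′) = step-resp α λ x y →
    (λ (β , β<α , g) → β , β<α , proj₁ (stage-irrelevant β (rs β<α) (rs′ β<α) x y) g) ,
    (λ (β , β<α , g) → β , β<α , proj₂ (stage-irrelevant β (rs β<α) (rs′ β<α) x y) g)

  Stage Below : Carrier → X → Y → Set ℓ
  Stage α = stage α (wellFounded α)
  Below α x y = ∃[ β ] β < α × Stage β x y

  unfold : ∀ α x y → Stage α x y ⟺ step α (Below α) x y
  unfold α with wellFounded α
  ... | acc rs = step-resp α λ x y →
    (λ (β , β<α , g) → β , β<α , proj₁ (stage-irrelevant β (rs β<α) (wellFounded β) x y) g) ,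
    (λ (β , β<α , g) → β , β<α , proj₂ (stage-irrelevant β (rs β<α) (wellFounded β) x y) g)

  stage-mono : ∀ {α β x y} → β < α → Stage β x y → Stage α x y
  stage-mono {α} {β} β<α g = proj₂ (unfold α _ _) (inflationary α (β , β<α , g))

module BackAndForth (em : ∀ {a} → ExcludedMiddle a) (κ : Cardinal ℓ)
  (inaccessible : IsStronglyInaccessible κ) {L : Language ℓ} (lt : Language.Relation L 2)
  (M : Structure L) (tame : Tame lt M) (cardinality : ∣ M ∣ ↔ Cardinal.Carrier κ)
  (saturated : IsSaturated M κ)
  (f : Fin k → ∣ M ∣ → ∣ M ∣) (f-def : ∀ i → IsZeroDefinable M (f i))
  (trivial : ∀ (A : Pred ∣ M ∣ ℓ) →
    dcl M A ≐ ((λ b → ∃[ i ] ∃[ a ] A a × f i a ≡ b) ∪ dcl M ∅)) where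

  open Classical em
  open Trivial em lt M tame f f-def trivial using (dcl-split; dcl-image)
  open PartialMaps em κ inaccessible lt M tame saturated f f-def trivial
  open Smallness em κ inaccessible
  open Cardinal κ
  open IsStrictTotalOrder isStrictTotalOrder using (compare) renaming (trans to <-trans)

  index : ∣ M ∣ → Carrier
  index = Inverse.to cardinality

  element : Carrier → ∣ M ∣
  element = Inverse.from cardinality

  element-index : ∀ x → element (index x) ≡ x
  element-index x = Inverse.strictlyInverseʳ cardinality x

  -- The well-order carried over from κ singles out a canonical witness, so that the stages are
  -- definite relations and no choices have to be recorded.
  Least : Pred ∣ M ∣ ℓ → Pred ∣ M ∣ ℓ
  Least Q x = Q x × (∀ y → Q y → ¬ (index y < index x))

  least-exists : ∀ {Q x} → Q x → ∃ (Least Q)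
  least-exists {Q} {x} Qx
    with least (Q ∘ element) {index x} (subst Q (sym (element-index x)) Qx)
  ... | β , Qβ , min = element β , Qβ , λ y Qy y<β →
    min (index y) (subst Q (sym (element-index y)) Qy)
        (subst (index y <_) (Inverse.strictlyInverseˡ cardinality β) y<β)

  least-unique : ∀ {Q x y} → Least Q x → Least Q y → x ≡ y
  least-unique {x = x} {y} (Qx , min) (Qy , min′) with compare (index x) (index y)
  ... | tri< p _ _ = ⊥-elim (min′ x Qx p)
  ... | tri> _ _ p = ⊥-elim (min y Qy p)
  ... | tri≈ _ p _ = trans (sym (element-index x)) (trans (cong element p) (element-index y))

  least-resp : ∀ {Q Q′} → (∀ {x} → Q x ⟺ Q′ x) → ∀ {x} → Least Q x → Least Q′ x
  least-resp eq (Qx , min) = proj₁ eq Qx , λ y Q′y → min y (proj₂ eq Q′y)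

  SmallGood : Pred ∣ M ∣ ℓ → Pred ∣ M ∣ ℓ → PartialMap → Set ℓ
  SmallGood D E G = Good D E G × Small (Dom G) × Small (Ran G)

  flip-smallGood : ∀ {D E G} → SmallGood D E G → SmallGood E D (flip G)
  flip-smallGood (good , small , small′) = flip-good good , small′ , small

  -- P is a request with at most one element. It may be empty, as `Source D c` is when c is not an
  -- image of a point of D; then nothing is added.
  record New (D E P : Pred ∣ M ∣ ℓ) (G : PartialMap) (x y : ∣ M ∣) : Set ℓ where
    constructor _via_
    field
      requested : P x
      minimal   : Least (λ z → Good D E (Extend G x z)) y

  Add : (D E P : Pred ∣ M ∣ ℓ) → PartialMap → PartialMap
  Add D E P G x y = G x y ⊎ New D E P G x y

  add-resp : ∀ {D E P G G′} → (∀ x y → G x y ⟺ G′ x y) → ∀ x y → Add D E P G x y ⟺ Add D E P G′ x y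
  add-resp {G = G} {G′} eq x y =
    Sum.map (proj₁ (eq x y)) (λ (Px via l) → Px via least-resp good-eq l) ,
    Sum.map (proj₂ (eq x y)) (λ (Px via l) → Px via least-resp (swap good-eq) l)
    where
    extend-eq : ∀ {z} u v → Extend G x z u v ⟺ Extend G′ x z u v
    extend-eq u v = Sum.map₁ (proj₁ (eq u v)) , Sum.map₁ (proj₂ (eq u v))
    good-eq : ∀ {z} → Good _ _ (Extend G x z) ⟺ Good _ _ (Extend G′ x z)
    good-eq = good-resp extend-eq , good-resp (λ u v → swap (extend-eq u v))

  new-unique : ∀ {D E P G} → (∀ {x x′} → P x → P x′ → x ≡ x′) →
               ∀ {x y x′ y′} → New D E P G x y → New D E P G x′ y′ → x ≡ x′ × y ≡ y′
  new-unique P-unique (Px via l) (Px′ via l′) with P-unique Px Px′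
  ... | refl = refl , least-unique l l′

  module _ {D E : Pred ∣ M ∣ ℓ} (D-generic : IsGeneric lt M f D) (E-generic : IsGeneric lt M f E)
    {P : Pred ∣ M ∣ ℓ} (P-unique : ∀ {x x′} → P x → P x′ → x ≡ x′)
    {G : PartialMap} (ok : SmallGood D E G) where

    new-exists : ∀ {c} → P c → Ready D G c → ∃ (Least (λ z → Good D E (Extend G c z)))
    new-exists Pc ready =
      least-exists (proj₂ (forth D-generic E-generic (proj₁ ok) (proj₂ (proj₂ ok)) ready))

    add-dom : ∀ {c} → P c → Ready D G c → Dom (Add D E P G) c
    add-dom Pc ready = let y , l = new-exists Pc ready in y , inj₂ (Pc via l)

    add-smallGood : (∀ {c} → P c → Ready D G c) → SmallGood D E (Add D E P G)
    add-smallGood ready = good ,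
      small-⊆ (λ { (y , inj₁ g) → inj₁ (y , g) ; (y , inj₂ l) → inj₂ (y , l) })
        (small-∪ (proj₁ (proj₂ ok)) (small-subsingleton {P = Dom (New D E P G)}
          (λ (_ , n) (_ , n′) → proj₁ (new-unique P-unique n n′)))) ,
      small-⊆ (λ { (x , inj₁ g) → inj₁ (x , g) ; (x , inj₂ l) → inj₂ (x , l) })
        (small-∪ (proj₂ (proj₂ ok)) (small-subsingleton {P = Ran (New D E P G)}
          (λ (_ , n) (_ , n′) → proj₂ (new-unique P-unique n n′))))
      where
      good : Good D E (Add D E P G)
      good with em {P = ∃ P}
      ... | no none = good-resp (λ x y → inj₁ , [ id , (λ (Px via _) → ⊥-elim (none (x , Px))) ]′) (proj₁ ok)
      ... | yes (c , Pc) with new-exists Pc (ready Pc)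
      ...   | z , l = good-resp (λ x y →
        Sum.map₂ (λ { (refl , refl) → Pc via l }) ,
        Sum.map₂ (λ l′ → new-unique P-unique l′ (Pc via l))) (proj₁ l)

  Chain : (Carrier → Set ℓ) → (Carrier → PartialMap) → PartialMap
  Chain I S x y = ∃[ β ] I β × S β x y

  -- An element of D definable over the union is by triviality the image of one point, so the
  -- closure condition of a single stage applies; `transcendental` excludes those definable over ∅,
  -- which settles the empty chain too.
  chain-good : ∀ {D E} → IsGeneric lt M f D → IsGeneric lt M f E → (I : Carrier → Set ℓ) (S : Carrier → PartialMap) →
               (∀ {α β x y} → β < α → S β x y → S α x y) →
               (∀ {β} → I β → Good D E (S β)) → Good D E (Chain I S)
  chain-good {D} {E} D-generic E-generic I S mono good = record
    { elementary = elementary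
    ; marked     = λ (β , Iβ , g) → Good.marked (good Iβ) g
    ; dom-closed = dom-closed
    ; ran-closed = ran-closed
    }
    where
    collect : ∀ {n x y} {xs ys : Vec ∣ M ∣ n} → Pointwise (Chain I S) (x ∷ xs) (y ∷ ys) →
              ∃[ β ] I β × Pointwise (S β) (x ∷ xs) (y ∷ ys)
    collect {xs = []} {[]} ((β , Iβ , g) ∷ []) = β , Iβ , g ∷ []
    collect {xs = _ ∷ _} {_ ∷ _} ((β , Iβ , g) ∷ gs) with collect gs
    ... | γ , Iγ , gs′ with compare β γ
    ...   | tri< β<γ _ _  = γ , Iγ , mono β<γ g ∷ gs′
    ...   | tri≈ _ refl _ = γ , Iγ , g ∷ gs′
    ...   | tri> _ _ γ<β  = β , Iβ , g ∷ Pointwise.map (mono γ<β) gs′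
    elementary : (θ : Formula L n) → ∀ {xs ys} → Pointwise (Chain I S) xs ys → Sat M θ xs ⟺ Sat M θ ys
    -- A sentence has no variable from which a stage could be read off, and the chain may be empty;
    -- but both sides are the same structure.
    elementary θ [] = id , id
    elementary θ gs@(_ ∷ _) with collect gs
    ... | β , Iβ , gs′ = Good.elementary (good Iβ) θ gs′
    dom-closed : ∀ {h} → D h → dcl M (Dom (Chain I S)) h → Dom (Chain I S) h
    dom-closed Dh p with dcl-split p
    ... | inj₂ q = ⊥-elim (IsGeneric.transcendental D-generic Dh q)
    ... | inj₁ (i , x , (y , β , Iβ , g) , refl) with Good.dom-closed (good Iβ) Dh (dcl-image i (y , g))
    ...   | z , g′ = z , β , Iβ , g′
    ran-closed : ∀ {h} → E h → dcl M (Ran (Chain I S)) h → Ran (Chain I S) h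
    ran-closed Eh p with dcl-split p
    ... | inj₂ q = ⊥-elim (IsGeneric.transcendental E-generic Eh q)
    ... | inj₁ (i , y , (x , β , Iβ , g) , refl) with Good.ran-closed (good Iβ) Eh (dcl-image i (x , g))
    ...   | z , g′ = z , β , Iβ , g′

  module Bijective {D E : Pred ∣ M ∣ ℓ} {G : PartialMap} (good : Good D E G)
    (total : ∀ x → Dom G x) (onto : ∀ y → Ran G y) where

    open Good good

    functional : ∀ {x y x′ y′} → G x y → G x′ y′ → (x ≡ x′) ⟺ (y ≡ y′)
    functional g g′ = elementary (var zero ≈ var (suc zero)) (g ∷ g′ ∷ [])

    image : ∣ M ∣ → ∣ M ∣
    image x = proj₁ (total x)

    image-related : ∀ x → G x (image x)
    image-related x = proj₂ (total x)

    images-related : (xs : Vec ∣ M ∣ n) → Pointwise G xs (Vec.map image xs)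
    images-related []       = []
    images-related (x ∷ xs) = image-related x ∷ images-related xs

    isomorphism : expand M D ≅ expand M E
    isomorphism = record
      { bijection = mk↔ₛ′ image (λ y → proj₁ (onto y))
          (λ y → proj₁ (functional (image-related _) (proj₂ (onto y))) refl)
          (λ x → proj₂ (functional (proj₂ (onto (image x))) (image-related x)) refl)
      ; to-func = λ g xs → sym (trans
          (cong (Structure.funcInt M g) (sym (evals-variables (image (Structure.funcInt M g xs)) (Vec.map image xs))))
          (sym (proj₁ (elementary (var zero ≈ app g (Vec.tabulate (var ∘ suc))) (image-related _ ∷ images-related xs))
            (cong (Structure.funcInt M g) (sym (evals-variables (Structure.funcInt M g xs) xs))))))
      ; to-rel = λ
        { (old R) xs →
            let to , from = elementary (rel R (Vec.tabulate var)) (images-related xs)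
                eq        = evals-lookup xs
                eq′       = evals-lookup (Vec.map image xs)
            in mk⇔ (λ p → subst (Structure.relInt M R) eq′ (to (subst (Structure.relInt M R) (sym eq) p)))
                   (λ p → subst (Structure.relInt M R) eq (from (subst (Structure.relInt M R) (sym eq′) p)))
        ; new (x ∷ []) → mk⇔ (proj₁ (marked (image-related x))) (proj₂ (marked (image-related x)))
        }
      }
      where
      evals-tabulate : (r : Fin n → Fin m) (ρ : Vec ∣ M ∣ m) →
                       evals M (Vec.tabulate (var ∘ r)) ρ ≡ Vec.tabulate (lookup ρ ∘ r)
      evals-tabulate {n = zero}  r ρ = refl
      evals-tabulate {n = suc n} r ρ = cong (lookup ρ (r zero) ∷_) (evals-tabulate (r ∘ suc) ρ)
      evals-variables : ∀ x (xs : Vec ∣ M ∣ n) → evals M (Vec.tabulate (var ∘ suc)) (x ∷ xs) ≡ xs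
      evals-variables x xs = trans (evals-tabulate suc (x ∷ xs)) (tabulate∘lookup xs)
      evals-lookup : (xs : Vec ∣ M ∣ n) → evals M (Vec.tabulate var) xs ≡ xs
      evals-lookup xs = trans (evals-tabulate id xs) (tabulate∘lookup xs)

  -- The element of D to be added before c when c ∈ dcl(D).
  Source : Pred ∣ M ∣ ℓ → ∣ M ∣ → Pred ∣ M ∣ ℓ
  Source D c = Least (λ h → D h × ∃[ i ] f i h ≡ c)

  AddSource AddPoint : (D E : Pred ∣ M ∣ ℓ) → ∣ M ∣ → PartialMap → PartialMap
  AddSource D E c = Add D E (Source D c)
  AddPoint D E c = Add D E (_≡ c)

  AddBoth : (D E : Pred ∣ M ∣ ℓ) → ∣ M ∣ → PartialMap → PartialMap
  AddBoth D E c G = AddPoint D E c (AddSource D E c G)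

  ≡-unique : ∀ {c x x′ : ∣ M ∣} → x ≡ c → x′ ≡ c → x ≡ x′
  ≡-unique p q = trans p (sym q)

  module _ {D E : Pred ∣ M ∣ ℓ} (D-generic : IsGeneric lt M f D) (E-generic : IsGeneric lt M f E)
    (c : ∣ M ∣) {G : PartialMap} (ok : SmallGood D E G) where

    private
      source-ready : ∀ {x} → Source D c x → Ready D G x
      source-ready ((Dx , _) , _) = inj₁ Dx

      ok′ : SmallGood D E (AddSource D E c G)
      ok′ = add-smallGood D-generic E-generic least-unique ok source-ready

      point-ready : Ready D (AddSource D E c G) c
      point-ready = inj₂ λ (h , dep) →
        let s , l = least-exists dep
        in s , add-dom D-generic E-generic least-unique ok l (source-ready l) , proj₂ (proj₁ l)

    addBoth-smallGood : SmallGood D E (AddBoth D E c G)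
    addBoth-smallGood = add-smallGood D-generic E-generic ≡-unique ok′ (λ { refl → point-ready })

    addBoth-dom : Dom (AddBoth D E c G) c
    addBoth-dom = add-dom D-generic E-generic ≡-unique ok′ refl point-ready

  addBoth-resp : ∀ {D E} c {G G′} → (∀ x y → G x y ⟺ G′ x y) →
                 ∀ x y → AddBoth D E c G x y ⟺ AddBoth D E c G′ x y
  addBoth-resp c eq = add-resp (add-resp eq)

  module Construction {D E : Pred ∣ M ∣ ℓ} (D-generic : IsGeneric lt M f D)
    (E-generic : IsGeneric lt M f E) where

    -- The inner half puts `element α` into the domain; the outer half, working on the inverse
    -- relation with D and E exchanged, puts it into the range.
    step : Carrier → PartialMap → PartialMap
    step α G = flip (AddBoth E D (element α) (flip (AddBoth D E (element α) G)))

    open Iteration κ step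
      (λ α eq x y → addBoth-resp (element α) (λ u v → addBoth-resp (element α) eq v u) y x)
      (λ α g → inj₁ (inj₁ (inj₁ (inj₁ g))))

    -- The four kinds of pair a stage can add, at most one of each: source and point on the domain
    -- side, then the same on the range side.
    New₁ New₂ New₃ New₄ : Carrier → PartialMap
    New₁ α = New D E (Source D (element α)) (Below α)
    New₂ α = New D E (_≡ element α) (AddSource D E (element α) (Below α))
    New₃ α = flip (New E D (Source E (element α)) (flip (AddBoth D E (element α) (Below α))))
    New₄ α = flip (New E D (_≡ element α)
      (AddSource E D (element α) (flip (AddBoth D E (element α) (Below α)))))

    AnyNew : Carrier → PartialMap
    AnyNew α x y = (New₁ α x y ⊎ New₂ α x y) ⊎ (New₃ α x y ⊎ New₄ α x y)

    Origin : Carrier → PartialMap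
    Origin α x y = ∃[ β ] (β < α ⊎ β ≡ α) × AnyNew β x y

    origin-step : ∀ α {x y} → (Below α x y → Origin α x y) → step α (Below α) x y → Origin α x y
    origin-step α below (inj₂ n)                      = α , inj₂ refl , inj₂ (inj₂ n)
    origin-step α below (inj₁ (inj₂ n))               = α , inj₂ refl , inj₂ (inj₁ n)
    origin-step α below (inj₁ (inj₁ (inj₂ n)))        = α , inj₂ refl , inj₁ (inj₂ n)
    origin-step α below (inj₁ (inj₁ (inj₁ (inj₂ n)))) = α , inj₂ refl , inj₁ (inj₁ n)
    origin-step α below (inj₁ (inj₁ (inj₁ (inj₁ b)))) = below b

    origin-mono : ∀ {α β x y} → β < α → Origin β x y → ∃[ γ ] γ < α × AnyNew γ x y
    origin-mono β<α (γ , inj₁ γ<β  , n) = γ , <-trans γ<β β<α , n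
    origin-mono β<α (γ , inj₂ refl , n) = γ , β<α , n

    origin : ∀ α → Acc _<_ α → ∀ {x y} → Stage α x y → Origin α x y
    origin α (acc rs) {x} {y} s = origin-step α
      (λ (β , β<α , s′) → let γ , γ<α , n = origin-mono β<α (origin β (rs β<α) s′) in γ , inj₁ γ<α , n)
      (proj₁ (unfold α x y) s)

    origin-below : ∀ {α x y} → Below α x y → ∃[ β ] β < α × AnyNew β x y
    origin-below (β , β<α , s) = origin-mono β<α (origin β (wellFounded β) s)

    -- Every pair is charged to the stage and kind of addition that introduced it. For a fixed kind
    -- the stage determines the pair, so `Below α` is covered by four sets coded by ordinals below
    -- α.
    below-small : ∀ α → Small (Dom (Below α)) × Small (Ran (Below α))
    below-small α =
      small-⊆ (λ {x} (y , b) → let β , β<α , n = origin-below b in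
                 Sum.map (Sum.map (λ n → β , β<α , y , n) (λ n → β , β<α , y , n))
                         (Sum.map (λ n → β , β<α , y , n) (λ n → β , β<α , y , n)) n)
        (small-∪
          (small-∪ (images New₁ Dom (λ (_ , n) (_ , n′) → proj₁ (new-unique least-unique n n′)))
                   (images New₂ Dom (λ (_ , n) (_ , n′) → proj₁ (new-unique ≡-unique n n′))))
          (small-∪ (images New₃ Dom (λ (_ , n) (_ , n′) → proj₂ (new-unique least-unique n n′)))
                   (images New₄ Dom (λ (_ , n) (_ , n′) → proj₂ (new-unique ≡-unique n n′))))) ,
      small-⊆ (λ {y} (x , b) → let β , β<α , n = origin-below b in
                 Sum.map (Sum.map (λ n → β , β<α , x , n) (λ n → β , β<α , x , n))
                         (Sum.map (λ n → β , β<α , x , n) (λ n → β , β<α , x , n)) n)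
        (small-∪
          (small-∪ (images New₁ Ran (λ (_ , n) (_ , n′) → proj₂ (new-unique least-unique n n′)))
                   (images New₂ Ran (λ (_ , n) (_ , n′) → proj₂ (new-unique ≡-unique n n′))))
          (small-∪ (images New₃ Ran (λ (_ , n) (_ , n′) → proj₁ (new-unique least-unique n n′)))
                   (images New₄ Ran (λ (_ , n) (_ , n′) → proj₁ (new-unique ≡-unique n n′)))))
      where
      images : (N : Carrier → PartialMap) (side : PartialMap → Pred ∣ M ∣ ℓ) →
               (∀ {β x y} → side (N β) x → side (N β) y → x ≡ y) →
               Small (λ x → ∃[ β ] β < α × side (N β) x)
      images N side = small-image α (λ β → side (N β))

    step-smallGood : ∀ α {G} → SmallGood D E G → SmallGood D E (step α G)
    step-smallGood α ok = flip-smallGood (addBoth-smallGood E-generic D-generic (element α)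
      (flip-smallGood (addBoth-smallGood D-generic E-generic (element α) ok)))

    -- The recursion starts by itself: at the least α, `Below α` is the empty chain, and
    -- `chain-good` makes the empty map good.
    stage-good : ∀ α → Acc _<_ α → Good D E (Stage α)
    below-smallGood : ∀ α → Acc _<_ α → SmallGood D E (Below α)

    stage-good α a = good-resp (λ x y → swap (unfold α x y))
      (proj₁ (step-smallGood α (below-smallGood α a)))

    below-smallGood α (acc rs) =
      chain-good D-generic E-generic (_< α) Stage stage-mono (λ β<α → stage-good _ (rs β<α)) ,
      below-small α

    Total : PartialMap
    Total = Chain (λ _ → Poly.⊤) Stage

    total-good : Good D E Total
    total-good = chain-good D-generic E-generic _ Stage stage-mono (λ {β} _ → stage-good β (wellFounded β))

    step-total : ∀ α {x y} → step α (Below α) x y → Total x y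
    step-total α {x} {y} g = α , _ , proj₂ (unfold α x y) g

    module _ (α : Carrier) where

      private
        c = element α

        ok : SmallGood D E (Below α)
        ok = below-smallGood α (wellFounded α)

        ok′ : SmallGood E D (flip (AddBoth D E c (Below α)))
        ok′ = flip-smallGood {D} {E} (addBoth-smallGood D-generic E-generic c ok)

      total-dom-element : Dom Total c
      total-dom-element =
        let y , g = addBoth-dom D-generic E-generic c ok in y , step-total α (inj₁ (inj₁ g))

      total-ran-element : Ran Total c
      total-ran-element =
        let x , g = addBoth-dom E-generic D-generic c ok′ in x , step-total α g

    total-dom : ∀ x → Dom Total x
    total-dom x = subst (Dom Total) (element-index x) (total-dom-element (index x))

    total-ran : ∀ x → Ran Total x
    total-ran x = subst (Ran Total) (element-index x) (total-ran-element (index x))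

    isomorphism : expand M D ≅ expand M E
    isomorphism = Bijective.isomorphism total-good total-dom total-ran

-- Invariance of satisfaction under isomorphism

module _ {L : Language ℓ} {M N : Structure L} (iso : M ≅ N) where

  open _≅_ iso
  open Inverse bijection using (to; from; strictlyInverseˡ; strictlyInverseʳ)

  private
    to-injective : ∀ {x y} → to x ≡ to y → x ≡ y
    to-injective {x} {y} p =
      trans (sym (strictlyInverseʳ x)) (trans (cong from p) (strictlyInverseʳ y))

  mutual
    to-eval : ∀ (s : Term L n) ρ → to (eval M s ρ) ≡ eval N s (Vec.map to ρ)
    to-eval (var i)    ρ = sym (lookup-map i to ρ)
    to-eval (app g ts) ρ = trans (to-func g (evals M ts ρ)) (cong (Structure.funcInt N g) (to-evals ts ρ))

    to-evals : ∀ (ts : Vec (Term L n) k) ρ → Vec.map to (evals M ts ρ) ≡ evals N ts (Vec.map to ρ)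
    to-evals []       ρ = refl
    to-evals (s ∷ ts) ρ = cong₂ _∷_ (to-eval s ρ) (to-evals ts ρ)

  iso-sat : ∀ (φ : Formula L n) ρ → Sat M φ ρ ⟺ Sat N φ (Vec.map to ρ)
  iso-sat falsum     ρ = (λ { (lift ()) }) , (λ { (lift ()) })
  iso-sat (s ≈ s′)   ρ =
    (λ p → trans (sym (to-eval s ρ)) (trans (cong to p) (to-eval s′ ρ))) ,
    (λ p → to-injective (trans (to-eval s ρ) (trans p (sym (to-eval s′ ρ)))))
  iso-sat (rel R ts) ρ =
    (λ p → subst (Structure.relInt N R) (to-evals ts ρ) (Equivalence.to (to-rel R (evals M ts ρ)) p)) ,
    (λ p → Equivalence.from (to-rel R (evals M ts ρ)) (subst (Structure.relInt N R) (sym (to-evals ts ρ)) p))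
  iso-sat (φ ⇒ ψ)    ρ =
    (λ p x → proj₁ (iso-sat ψ ρ) (p (proj₂ (iso-sat φ ρ) x))) ,
    (λ p x → proj₂ (iso-sat ψ ρ) (p (proj₁ (iso-sat φ ρ) x)))
  iso-sat (all φ)    ρ =
    (λ p y → subst (λ z → Sat N φ (z ∷ Vec.map to ρ)) (strictlyInverseˡ y)
               (proj₁ (iso-sat φ (from y ∷ ρ)) (p (from y)))) ,
    (λ p x → proj₂ (iso-sat φ (x ∷ ρ)) (p (to x)))

proposition4p3 : (∀ {a} → ExcludedMiddle a) →
    ∀ {ℓ : Level} (κ : Cardinal ℓ) → IsStronglyInaccessible κ →
    (L : Language ℓ) → CardLess {X = Symbol L} U κ →
    (lt : Language.Relation L 2) (T : Theory L ℓ) → IsOMinimalTheory lt T →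
    (M : Structure L) → IsMonster κ T M →
    (k : ℕ) (f : Fin k → ∣ M ∣ → ∣ M ∣) → (∀ i → IsZeroDefinable M (f i)) →
    (∀ (A : Pred ∣ M ∣ ℓ) →
    dcl M A ≐ ((λ b → ∃[ i ] ∃[ a ] A a × f i a ≡ b) ∪ dcl M ∅)) →
    (H : Pred ∣ M ∣ ℓ) → IsMonster κ (Tindep T) (expand M H) →
    o M H ≐ e M H
proposition4p3 em κ inaccessible L _ lt T (R , omin , T≐ThR) M monster k f f-def trivial H H-monster =
  (λ iso → (λ {σ} → proj₁ (iso-sat iso σ [])) , (λ {σ} → proj₂ (iso-sat iso σ []))) ,
  -- D satisfies the sentences true of H, in particular those of `Tindep T`, so both predicates are
  -- generic and the back-and-forth applies to them.
  (λ {D} (H⊆D , _) → isomorphism (generic H⊨) (generic {D} (λ σ p → H⊆D {σ} (H⊨ σ p))))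
  where
  open IsMonster monster
  open Generic lt em T R omin T≐ThR M model f f-def using (generic)
  open BackAndForth em κ inaccessible lt M (OMinimal.tame lt em T R omin T≐ThR model)
    cardinality saturated f f-def trivial
  open Construction using (isomorphism)
  H⊨ : expand M H ⊨ Tindep T
  H⊨ = IsMonster.model H-monster
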